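{- Let $0<p<1$ and let $k\ge 1$ be an integer. A coin showing heads (H) with probability $p$ and tails (T) with probability $1-p$ is flipped independently until $k$ consecutive heads $\mathrm{H}^k$ first appear; let $Y$ be the number of flips. Then $E(Y^0)=1$ and for every $n\ge 1$, \[ E(Y^n) = k^n + \sum_{j=0}^{n-1} \binom{n}{j} E(Y^j) \sum_{i=1}^k \frac{(1-p)\,i^{n-j}}{p^{k-i+1}} = k^n + \sum_{j=0}^{n-1} \binom{n}{j} E(Y^j) \sum_{i=0}^n \frac{e_{n-j,i}\, p^i - e_{n-j,i}^k\, p^{k+i+1}}{(1-p)^{n-j}p^{k+1}}. \]
   Context: The Eulerian numbers $e_{n,i}$ are defined by $e_{0,0}=1$, $e_{n,i}=0$ whenever $i\le 0$ (unless $n=i=0$) or $i>n$, and $e_{n,i}=i\,e_{n-1,i}+(n-i+1)\,e_{n-1,i-1}$ otherwise. For the integer parameter $k$, $e^k_{0,0}=1$, $e^k_{n,i}=0$ whenever $i<0$ or $i>n$, and $e^k_{n,i}=(k+i+1)\,e^k_{n-1,i}+(n-k-i)\,e^k_{n-1,i-1}$ otherwise. -}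

module Defs where

open import Algebra.Apartness.Bundles using (HeytingField)
open import Algebra.Bundles using (CommutativeRing; Semiring)
open import Data.Bool.Base using (if_then_else_; _∨_)
open import Data.Integer.Base as ℤ using (ℤ; +_; -[1+_])
import Data.Integer.Properties as ℤ
open import Data.List.Base using (List; []; _∷_; map; foldr; filter; replicate; take; length; cartesianProductWith)
open import Data.List.Relation.Binary.Infix.Heterogeneous using (Infix)
open import Data.List.Relation.Binary.Infix.Heterogeneous.Properties using (infix?)
open import Data.Nat.Base as ℕ using (ℕ; zero; suc)
open import Data.Nat.Properties using (allUpTo?)
open import Data.Fin.Base using (toℕ)
open import Data.Product.Base using (∃; _×_; _,_; proj₁; proj₂)
open import Data.Sum.Base using (_⊎_; inj₁; inj₂)
open import Level using (Level; _⊔_) renaming (suc to lsuc)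
open import Relation.Binary.Core using (Rel)
open import Relation.Binary.Definitions using (DecidableEquality)
open import Relation.Binary.PropositionalEquality.Core using (_≡_; refl)
open import Relation.Binary.Structures using (IsStrictPartialOrder)
open import Relation.Nullary using (¬_; Dec; yes; no; does; ¬?; _×-dec_)
import Algebra.Definitions.RawSemiring as RawSemiringDefinitions
import Algebra.Properties.CommutativeMonoid.Sum as Sum
import Algebra.Properties.Ring as RingProperties

------------------------------------------------------------------------
-- Eulerian numbers

-- The second index is an arbitrary integer, as in the recurrences.

eulerian : ℕ → ℤ → ℤ
eulerian zero    i = if does (i ℤ.≟ + 0) then + 1 else + 0
eulerian (suc n) i =
  if does (i ℤ.≤? + 0) ∨ does (+ suc n ℤ.<? i) then + 0 else
  i ℤ.* eulerian n i ℤ.+ (+ suc n ℤ.- i ℤ.+ + 1) ℤ.* eulerian n (i ℤ.- + 1)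

eulerianᵏ : ℤ → ℕ → ℤ → ℤ
eulerianᵏ k zero    i = if does (i ℤ.≟ + 0) then + 1 else + 0
eulerianᵏ k (suc n) i =
  if does (i ℤ.<? + 0) ∨ does (+ suc n ℤ.<? i) then + 0 else
  (k ℤ.+ i ℤ.+ + 1) ℤ.* eulerianᵏ k n i
    ℤ.+ (+ suc n ℤ.- k ℤ.- i) ℤ.* eulerianᵏ k n (i ℤ.- + 1)

------------------------------------------------------------------------
-- Archimedean ordered fields

-- The real numbers are the intended model.  Only axioms valid for both
-- the classical and the constructive reals are required: the order need
-- not be decidable, and inverses exist for elements apart from 0.

record ArchimedeanOrderedField (c ℓ₁ ℓ₂ ℓ₃ : Level) : Set (lsuc (c ⊔ ℓ₁ ⊔ ℓ₂ ⊔ ℓ₃)) where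
  infix 4 _<_
  field
    heytingField : HeytingField c ℓ₁ ℓ₂

  open HeytingField heytingField public
    hiding (refl; sym; trans; reflexive; isEquivalence)

  field
    _<_                  : Rel Carrier ℓ₃
    isStrictPartialOrder : IsStrictPartialOrder _≈_ _<_
    #⇒<⊎>                : ∀ {x y} → x # y → x < y ⊎ y < x
    <⇒#                  : ∀ {x y} → x < y → x # y
    +-monoˡ-<            : ∀ z {x y} → x < y → x + z < y + z
    *-pos                : ∀ {x y} → 0# < x → 0# < y → 0# < x * y

  open IsStrictPartialOrder isStrictPartialOrder public
    using (<-resp-≈; <-respˡ-≈; <-respʳ-≈)
    renaming (irrefl to <-irrefl; trans to <-trans; asym to <-asym)

  commutativeRing : CommutativeRing c ℓ₁
  commutativeRing = record { isCommutativeRing = isCommutativeRing }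

  open CommutativeRing commutativeRing public
    using (refl; sym; trans; reflexive; isEquivalence; ring; semiring; +-commutativeMonoid)
  open RawSemiringDefinitions (Semiring.rawSemiring semiring) public
    using (_^_) renaming (_×_ to _·_)
  open Sum +-commutativeMonoid public using (sum; sum-syntax)

  fromℕ : ℕ → Carrier
  fromℕ n = n · 1#

  field
    archimedean : ∀ x → ∃ λ n → x < fromℕ n

  fromℤ : ℤ → Carrier
  fromℤ (+ n)    = fromℕ n
  fromℤ -[1+ n ] = - fromℕ (suc n)

  x<y⇒0<y-x : ∀ {x y} → x < y → 0# < y - x
  x<y⇒0<y-x {x} x<y = <-respˡ-≈ (-‿inverseʳ x) (+-monoˡ-< (- x) x<y)

  0<1 : 0# < 1#
  0<1 with #⇒<⊎> (invertible⇒# (1# , 1*[1-0]≈1 , trans (*-comm _ _) 1*[1-0]≈1))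
    where
    open RingProperties ring using (-0#≈0#)
    1*[1-0]≈1 : 1# * (1# - 0#) ≈ 1#
    1*[1-0]≈1 = trans (*-identityˡ _) (trans (+-congˡ -0#≈0#) (+-identityʳ 1#))
  ... | inj₂ 0<1′ = 0<1′
  ... | inj₁ 1<0  = <-respʳ-≈ -1*-1≈1 (*-pos 0<-1 0<-1)
    where
    open RingProperties ring using (-1*x≈-x; -‿involutive)
    0<-1 : 0# < - 1#
    0<-1 = <-respʳ-≈ (+-identityˡ _) (x<y⇒0<y-x 1<0)
    -1*-1≈1 : - 1# * - 1# ≈ 1#
    -1*-1≈1 = trans (-1*x≈-x (- 1#)) (-‿involutive 1#)

  ^-pos : ∀ {x} n → 0# < x → 0# < x ^ n
  ^-pos zero    0<x = 0<1
  ^-pos (suc n) 0<x = *-pos 0<x (^-pos n 0<x)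

  pos⇒inverse : ∀ {x} → 0# < x → ∃ λ x⁻¹ → x * x⁻¹ ≈ 1#
  pos⇒inverse {x} 0<x with #⇒invertible (#-sym (<⇒# 0<x))
  ... | x⁻¹ , _ , [x-0]x⁻¹≈1 = x⁻¹ , trans (*-congʳ (sym x-0≈x)) [x-0]x⁻¹≈1
    where
    open RingProperties ring using (-0#≈0#)
    x-0≈x : x - 0# ≈ x
    x-0≈x = trans (+-congˡ -0#≈0#) (+-identityʳ x)

  infixl 7 _/_[_]
  _/_[_] : Carrier → ∀ y → 0# < y → Carrier
  x / y [ 0<y ] = x * proj₁ (pos⇒inverse 0<y)

  infix 4 _⟶_
  _⟶_ : (ℕ → Carrier) → Carrier → Set (c ⊔ ℓ₃)
  a ⟶ l = ∀ ε → 0# < ε → ∃ λ N → ∀ n → N ℕ.≤ n → (- ε < a n - l) × (a n - l < ε)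

------------------------------------------------------------------------
-- Coin flips

data Coin : Set where
  H T : Coin

infix 4 _≟_
_≟_ : DecidableEquality Coin
H ≟ H = yes refl
H ≟ T = no λ ()
T ≟ H = no λ ()
T ≟ T = yes refl

outcomes : ℕ → List (List Coin)
outcomes zero    = [] ∷ []
outcomes (suc m) = cartesianProductWith _∷_ (H ∷ T ∷ []) (outcomes m)

-- Hᵏ occurs as a block of consecutive flips.
Appears : ℕ → List Coin → Set
Appears k w = Infix _≡_ (replicate k H) w

appears? : ∀ k w → Dec (Appears k w)
appears? k w = infix? _≟_ (replicate k H) w

-- Hᵏ has appeared after the whole of w, but not after any smaller
-- number of flips.
FirstAppears : ℕ → List Coin → Set
FirstAppears k w = Appears k w × (∀ {m} → m ℕ.< length w → ¬ Appears k (take m w))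

firstAppears? : ∀ k w → Dec (FirstAppears k w)
firstAppears? k w =
  appears? k w ×-dec allUpTo? (λ m → ¬? (appears? k (take m w))) (length w)

module CoinFlips {c ℓ₁ ℓ₂ ℓ₃} (F : ArchimedeanOrderedField c ℓ₁ ℓ₂ ℓ₃)
                 (p : ArchimedeanOrderedField.Carrier F) (k : ℕ) where
  open ArchimedeanOrderedField F hiding (refl)

  flipProbability : Coin → Carrier
  flipProbability H = p
  flipProbability T = 1# - p

  -- Independent flips.
  probability : List Coin → Carrier
  probability w = foldr _*_ 1# (map flipProbability w)

  -- The event Y = m is determined by the first m flips, so its probability
  -- is the total probability of the m-flip outcomes that realise it.
  P[Y≡_] : ℕ → Carrier
  P[Y≡ m ] = foldr _+_ 0# (map probability (filter (firstAppears? k) (outcomes m)))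

  -- E(Yⁿ) = e.  The terms of Σₘ mⁿ P(Y = m) are nonnegative, so
  -- convergence of the partial sums is the existence of the expectation.
  -- The instance n = 0, e = 1 says that Y is almost surely finite.
  infix 4 E[Y^_]≈_
  E[Y^_]≈_ : ℕ → Carrier → Set (c ⊔ ℓ₃)
  E[Y^ n ]≈ e = (λ N → ∑[ m < N ] (fromℕ (toℕ m) ^ n * P[Y≡ toℕ m ])) ⟶ e

{-# OPTIONS --safe #-}
-- Conditioning on the first tail: with probability pⁱ (1 - p), i < k, the first
-- i + 1 flips are HⁱT and the experiment starts afresh, and with probability pᵏ
-- it stops after k flips.  Hence the truncated moments
-- S n N = Σ_{m<N} mⁿ P(Y = m) satisfy the recurrence of the theorem up to a
-- nonnegative remainder.  Dropping the remainder bounds every S n, by induction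
-- on n.  Boundedness of S (n + 1) makes mⁿ P(Y = m), and with it the remainder,
-- O(1/m), so that S n N differs by O(1/N) from the solution of the recurrence.
-- This exhibits the limit, so no completeness of the field is needed.
--
-- For the Eulerian form, let Gₖ(x) = Σᵢ eᵏ_{m,i} xⁱ.  Comparing the recurrences
-- for k and k + 1 gives Gₖ(x) = (k + 1)ᵐ (1 - x)^{m+1} + x Gₖ₊₁(x), the case
-- k = -1 being that of the classical Eulerian numbers, and the sum over i ≤ k
-- telescopes.
module Submission where

open import Defs
open import Algebra.Bundles using (CommutativeRing)
import Algebra.Properties.CommutativeSemiring.Binomial as Binomial
import Algebra.Properties.Monoid.Mult.TCOptimised as MultTCO
import Algebra.Properties.Ring as RingProperties
import Algebra.Properties.Semiring.Exp as Exp
import Algebra.Properties.Semiring.Mult as SemiringMult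
import Algebra.Solver.Ring as RingSolver
open import Algebra.Solver.Ring.AlmostCommutativeRing using (fromCommutativeRing; _-Raw-AlmostCommutative⟶_)
open import Data.Bool.Base using (Bool; true; false; if_then_else_)
open import Data.Empty using (⊥-elim)
open import Data.Fin.Base using (toℕ)
open import Data.Integer.Base as ℤ using (ℤ; +_; -[1+_])
import Data.Integer.Properties as ℤ
open import Data.List.Base using (List; []; _∷_; _++_; length; replicate; take; filter; foldr; map)
open import Data.List.Properties using (length-replicate; length-++; ++-identityʳ)
open import Data.List.Relation.Binary.Infix.Heterogeneous using (here; there)
open import Data.List.Relation.Binary.Infix.Heterogeneous.Properties using (length-mono; fromPointwise)
import Data.List.Relation.Binary.Pointwise as Pointwise
open import Data.List.Relation.Binary.Prefix.Heterogeneous using (Prefix; []; _∷_)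
open import Data.Maybe.Base using (just; nothing)
open import Data.Nat.Base as ℕ using (ℕ; zero; suc; z≤n; s≤s; s≤s⁻¹; _∸_)
open import Data.Nat.Combinatorics using (_C_; nCn≡1)
open import Data.Nat.Induction using (<-rec)
import Data.Nat.Properties as ℕ
open import Data.Product.Base using (_×_; _,_; proj₁; ∃; proj₂)
open import Data.Sum.Base using (_⊎_; inj₁; inj₂)
open import Function.Base using (_∘_)
open import Level using (_⊔_)
open import Relation.Binary.Bundles using (StrictPartialOrder)
import Relation.Binary.Construct.StrictToNonStrict as ToNonStrict
open import Relation.Binary.Definitions using (WeaklyDecidable)
import Relation.Binary.PropositionalEquality as ≡
open ≡ using (_≡_)
import Relation.Binary.Reasoning.Setoid as SetoidReasoning
import Relation.Binary.Reasoning.StrictPartialOrder as StrictReasoning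
open import Relation.Nullary using (¬_; Dec; does; yes; no)

-- `FirstAppears` quantifies over all prefixes, so it does not interact well with conditioning on
-- single flips. `completes` decides it in one pass whose only state is the number of missing heads,
-- and each flip acts on that state by definition. In the recurrence the n-th moment also stands on
-- the right, with coefficient Σ_{i<k} pⁱ (1 - p) = 1 - pᵏ. Moving it to the left leaves the factor
-- pᵏ, invertible because p > 0; this factor is cancelled both in the bounds and in the error
-- estimate. Since the order need not be decidable, x ≤ y means x < y or x ≈ y. The bounds on
-- moments and errors are therefore assembled from sums and products of quantities already known to
-- be nonnegative. The error is itself written in this way, so that its sign and its size follow
-- from the same induction.

-- First appearance of a run of heads, read off by a one-pass automaton

¬prefix-run : ∀ {a k w} → a ℕ.< k → ¬ Prefix _≡_ (replicate k H) (replicate a H ++ T ∷ w)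
¬prefix-run {zero}  {suc k} _         (() ∷ _)
¬prefix-run {suc a} {suc k} (s≤s a<k) (_ ∷ pre) = ¬prefix-run a<k pre

-- A block of k heads starting in one of the first a + 1 positions would have to cover the tail,
-- since a < k.
appears-strip : ∀ a {k w} → a ℕ.< k → Appears k (replicate a H ++ T ∷ w) → Appears k w
appears-strip zero    a<k (here pre)  = ⊥-elim (¬prefix-run {0} a<k pre)
appears-strip (suc a) a<k (here pre)  = ⊥-elim (¬prefix-run {suc a} a<k pre)
appears-strip zero    a<k (there inf) = inf
appears-strip (suc a) a<k (there inf) = appears-strip a (ℕ.<-trans (ℕ.n<1+n a) a<k) inf

appears-extend : ∀ a {k w} → Appears k w → Appears k (replicate a H ++ T ∷ w)
appears-extend zero    inf = there inf
appears-extend (suc a) inf = there (appears-extend a inf)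

¬appears-short : ∀ {k w} → length w ℕ.< k → ¬ Appears k w
¬appears-short {k} {w} ∣w∣<k inf = ℕ.<⇒≱ ∣w∣<k (≡.subst (ℕ._≤ length w) (length-replicate k) (length-mono inf))

appears-run : ∀ k → Appears k (replicate k H)
appears-run k = fromPointwise (Pointwise.refl ≡.refl)

take-past-run : ∀ a m {w} → take (a ℕ.+ suc m) (replicate a H ++ T ∷ w) ≡ replicate a H ++ T ∷ take m w
take-past-run zero    m = ≡.refl
take-past-run (suc a) m = ≡.cong (H ∷_) (take-past-run a m)

take-run : ∀ a {w} → take a (replicate a H ++ w) ≡ replicate a H
take-run zero    = ≡.refl
take-run (suc a) = ≡.cong (H ∷_) (take-run a)

length-run-++ : ∀ a w → length (replicate a H ++ w) ≡ a ℕ.+ length w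
length-run-++ a w = ≡.trans (length-++ (replicate a H)) (≡.cong (ℕ._+ length w) (length-replicate a))

length-take-≤ : ∀ m (w : List Coin) → length (take m w) ℕ.≤ m
length-take-≤ zero    w       = z≤n
length-take-≤ (suc m) []      = z≤n
length-take-≤ (suc m) (x ∷ w) = s≤s (length-take-≤ m w)

first-strip : ∀ a {k w} → a ℕ.< k → FirstAppears k (replicate a H ++ T ∷ w) → FirstAppears k w
first-strip a {k} {w} a<k (app , min) = appears-strip a a<k app , λ {m} m<∣w∣ app′ →
  min {a ℕ.+ suc m}
    (≡.subst (a ℕ.+ suc m ℕ.<_) (≡.sym (length-run-++ a (T ∷ w))) (ℕ.+-monoʳ-< a (s≤s m<∣w∣)))
    (≡.subst (Appears k) (≡.sym (take-past-run a m)) (appears-extend a app′))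

-- A prefix of length at most a is shorter than k; a longer one contains the tail, and
-- `appears-strip` reduces it to a proper prefix of `w`.
first-extend : ∀ a {k w} → a ℕ.< k → FirstAppears k w → FirstAppears k (replicate a H ++ T ∷ w)
first-extend a {k} {w} a<k (app , min) = appears-extend a app , ¬early
  where
  ¬early : ∀ {m} → m ℕ.< length (replicate a H ++ T ∷ w) → ¬ Appears k (take m (replicate a H ++ T ∷ w))
  ¬early {m} m<len app′ with m ℕ.≤? a
  ... | yes m≤a = ¬appears-short (ℕ.≤-<-trans (ℕ.≤-trans (length-take-≤ m _) m≤a) a<k) app′
  ... | no  m≰a with ℕ.m≤n⇒∃[o]m+o≡n (ℕ.≰⇒> m≰a)
  ... | o , ≡.refl = min
    (s≤s⁻¹ (ℕ.+-cancelˡ-< a (suc o) (suc (length w))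
      (≡.subst₂ ℕ._<_ (≡.sym (ℕ.+-suc a o)) (length-run-++ a (T ∷ w)) m<len)))
    (appears-strip a a<k (≡.subst (Appears k) (≡.trans (≡.cong (λ l → take l (replicate a H ++ T ∷ w)) (≡.sym (ℕ.+-suc a o))) (take-past-run a o)) app′))

run-∷ : ∀ a w → replicate a H ++ H ∷ w ≡ replicate (suc a) H ++ w
run-∷ zero    w = ≡.refl
run-∷ (suc a) w = ≡.cong (H ∷_) (run-∷ a w)

-- Whether Hᵏ is completed exactly by the last flip of w, when the flips
-- preceding w end in a run that lacks r heads.
completes : ℕ → ℕ → List Coin → Bool
completes k zero    []      = true
completes k zero    (_ ∷ _) = false
completes k (suc r) []      = false
completes k (suc r) (H ∷ w) = completes k r w
completes k (suc r) (T ∷ w) = completes k k w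

-- `replicate a H` is the current run and a + r = k the invariant of the automaton: a head moves
-- from the word into the run, while at a tail the run is discarded by `first-extend` and the pass
-- restarts with a = 0.
completes-sound : ∀ {k} a r w → a ℕ.+ r ≡ k → completes k r w ≡ true → FirstAppears k (replicate a H ++ w)
completes-sound {k} a zero [] a+0≡k _ with ≡.refl ← ≡.trans (≡.sym (ℕ.+-identityʳ a)) a+0≡k =
  ≡.subst (FirstAppears k) (≡.sym (++-identityʳ _))
    (appears-run k , λ {m} m<len → ¬appears-short
      (ℕ.≤-<-trans (length-take-≤ m _) (≡.subst (m ℕ.<_) (length-replicate k) m<len)))
completes-sound a (suc r) (H ∷ w) a+r≡k c = ≡.subst (FirstAppears _) (≡.sym (run-∷ a w))
  (completes-sound (suc a) r w (≡.trans (≡.sym (ℕ.+-suc a r)) a+r≡k) c)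
completes-sound a (suc r) (T ∷ w) ≡.refl c =
  first-extend a (ℕ.m<m+n a (s≤s z≤n)) (completes-sound 0 (a ℕ.+ suc r) w ≡.refl c)

completes-complete : ∀ {k} a r w → a ℕ.+ r ≡ k → FirstAppears k (replicate a H ++ w) → completes k r w ≡ true
completes-complete a zero    []      _ _ = ≡.refl
-- With no head missing, Hᵏ has appeared after a flips already, so a further flip contradicts
-- minimality.
completes-complete {k} a zero (x ∷ w) a+0≡k (_ , min) with ≡.refl ← ≡.trans (≡.sym (ℕ.+-identityʳ a)) a+0≡k =
  ⊥-elim (min {a} (≡.subst (a ℕ.<_) (≡.sym (length-run-++ a (x ∷ w))) (ℕ.m<m+n a (s≤s z≤n)))
    (≡.subst (Appears a) (≡.sym (take-run a)) (appears-run a)))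
completes-complete a (suc r) [] ≡.refl (app , _) = ⊥-elim (¬appears-short
  (≡.subst (ℕ._< a ℕ.+ suc r) (≡.sym (≡.trans (length-run-++ a []) (ℕ.+-identityʳ a))) (ℕ.m<m+n a (s≤s z≤n))) app)
completes-complete a (suc r) (H ∷ w) a+r≡k first =
  completes-complete (suc a) r w (≡.trans (≡.sym (ℕ.+-suc a r)) a+r≡k) (≡.subst (FirstAppears _) (run-∷ a w) first)
completes-complete a (suc r) (T ∷ w) ≡.refl first =
  completes-complete 0 (a ℕ.+ suc r) w ≡.refl (first-strip a (ℕ.m<m+n a (s≤s z≤n)) first)

does-⇔-true : ∀ {A : Set} (A? : Dec A) b → (A → b ≡ true) → (b ≡ true → A) → does A? ≡ b
does-⇔-true (yes a) b     a⇒b b⇒a = ≡.sym (a⇒b a)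
does-⇔-true (no ¬a) true  a⇒b b⇒a = ⊥-elim (¬a (b⇒a ≡.refl))
does-⇔-true (no ¬a) false a⇒b b⇒a = ≡.refl

firstAppears?-completes : ∀ k w → does (firstAppears? k w) ≡ completes k k w
firstAppears?-completes k w = does-⇔-true (firstAppears? k w) (completes k k w)
  (completes-complete 0 k w ≡.refl) (completes-sound 0 k w ≡.refl)

-- Arithmetic, order, sums and limits in an Archimedean ordered field

module OrderedField {c ℓ₁ ℓ₂ ℓ₃} (F : ArchimedeanOrderedField c ℓ₁ ℓ₂ ℓ₃) where
  open ArchimedeanOrderedField F public hiding (zero)
  open CommutativeRing commutativeRing public using (commutativeSemiring; +-monoid)
  open RingProperties ring public using (-0#≈0#; -‿involutive; -‿distribˡ-*; -‿distribʳ-*; -‿+-comm)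
  open Exp semiring public using (^-homo-*; ^-congˡ; ^-congʳ)
  open SemiringMult semiring public using (×1-homo-*; ×-homo-+; ×-assoc-*; ×-congʳ)
  open SetoidReasoning setoid

  fromℕ-+ : ∀ m n → fromℕ (m ℕ.+ n) ≈ fromℕ m + fromℕ n
  fromℕ-+ = ×-homo-+ 1#

  fromℕ-* : ∀ m n → fromℕ (m ℕ.* n) ≈ fromℕ m * fromℕ n
  fromℕ-* = ×1-homo-*

  -- The integers in the field

  fromℤ-neg : ∀ i → fromℤ (ℤ.- i) ≈ - fromℤ i
  fromℤ-neg (+ zero)  = sym -0#≈0#
  fromℤ-neg (+ suc n) = refl
  fromℤ-neg -[1+ n ]  = sym (-‿involutive _)

  [z+x]-[z+y]≈x-y : ∀ x y z → (z + x) - (z + y) ≈ x - y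
  [z+x]-[z+y]≈x-y x y z = begin
    (z + x) - (z + y)       ≈⟨ +-cong (+-comm z x) (sym (-‿+-comm z y)) ⟩
    (x + z) + (- z + - y)   ≈⟨ +-assoc x z _ ⟩
    x + (z + (- z + - y))   ≈⟨ +-congˡ (+-assoc z (- z) (- y)) ⟨
    x + ((z - z) + - y)     ≈⟨ +-congˡ (+-congʳ (-‿inverseʳ z)) ⟩
    x + (0# + - y)          ≈⟨ +-congˡ (+-identityˡ (- y)) ⟩
    x - y                   ∎

  fromℤ-⊖ : ∀ m n → fromℤ (m ℤ.⊖ n) ≈ fromℕ m - fromℕ n
  fromℤ-⊖ m       zero    = sym (trans (+-congˡ -0#≈0#) (+-identityʳ _))
  fromℤ-⊖ zero    (suc n) = sym (+-identityˡ _)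
  fromℤ-⊖ (suc m) (suc n) = begin
    fromℤ (suc m ℤ.⊖ suc n)        ≡⟨ ≡.cong fromℤ (ℤ.[1+m]⊖[1+n]≡m⊖n m n) ⟩
    fromℤ (m ℤ.⊖ n)                ≈⟨ fromℤ-⊖ m n ⟩
    fromℕ m - fromℕ n              ≈⟨ [z+x]-[z+y]≈x-y (fromℕ m) (fromℕ n) 1# ⟨
    fromℕ (suc m) - fromℕ (suc n)  ∎

  fromℤ-+ : ∀ i j → fromℤ (i ℤ.+ j) ≈ fromℤ i + fromℤ j
  fromℤ-+ (+ m)    (+ n)    = fromℕ-+ m n
  fromℤ-+ (+ m)    -[1+ n ] = fromℤ-⊖ m (suc n)
  fromℤ-+ -[1+ m ] (+ n)    = trans (fromℤ-⊖ n (suc m)) (+-comm _ _)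
  fromℤ-+ -[1+ m ] -[1+ n ] = begin
    - fromℕ (suc (suc (m ℕ.+ n)))        ≡⟨ ≡.cong (λ l → - fromℕ (suc l)) (ℕ.+-suc m n) ⟨
    - fromℕ (suc m ℕ.+ suc n)            ≈⟨ -‿cong (fromℕ-+ (suc m) (suc n)) ⟩
    - (fromℕ (suc m) + fromℕ (suc n))    ≈⟨ -‿+-comm _ _ ⟨
    - fromℕ (suc m) + - fromℕ (suc n)    ∎

  fromℤ-+* : ∀ m j → fromℤ (+ m ℤ.* j) ≈ fromℕ m * fromℤ j
  fromℤ-+* m (+ n) = trans (reflexive (≡.cong fromℤ (≡.sym (ℤ.pos-* m n)))) (fromℕ-* m n)
  fromℤ-+* m -[1+ n ] = begin
    fromℤ (+ m ℤ.* ℤ.- (+ suc n))   ≡⟨ ≡.cong fromℤ (ℤ.neg-distribʳ-* (+ m) (+ suc n)) ⟨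
    fromℤ (ℤ.- (+ m ℤ.* + suc n))   ≈⟨ fromℤ-neg (+ m ℤ.* + suc n) ⟩
    - fromℤ (+ m ℤ.* + suc n)       ≈⟨ -‿cong (fromℤ-+* m (+ suc n)) ⟩
    - (fromℕ m * fromℕ (suc n))     ≈⟨ -‿distribʳ-* _ _ ⟩
    fromℕ m * - fromℕ (suc n)       ∎

  fromℤ-* : ∀ i j → fromℤ (i ℤ.* j) ≈ fromℤ i * fromℤ j
  fromℤ-* (+ m)    j = fromℤ-+* m j
  fromℤ-* -[1+ m ] j = begin
    fromℤ (ℤ.- (+ suc m) ℤ.* j)     ≡⟨ ≡.cong fromℤ (ℤ.neg-distribˡ-* (+ suc m) j) ⟨
    fromℤ (ℤ.- (+ suc m ℤ.* j))     ≈⟨ fromℤ-neg (+ suc m ℤ.* j) ⟩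
    - fromℤ (+ suc m ℤ.* j)         ≈⟨ -‿cong (fromℤ-+* (suc m) j) ⟩
    - (fromℕ (suc m) * fromℤ j)     ≈⟨ -‿distribˡ-* _ _ ⟩
    - fromℕ (suc m) * fromℤ j       ∎

  open MultTCO +-monoid using () renaming (_×_ to _×′_)

  -- Unlike fromℤ, this sends 1 to 1# (not 1# + 0#) definitionally, so that
  -- solver constants match the goals.
  ⟦_⟧ℤ : ℤ → Carrier
  ⟦ + n ⟧ℤ      = n ×′ 1#
  ⟦ -[1+ n ] ⟧ℤ = - (suc n ×′ 1#)

  ⟦⟧ℤ≈fromℤ : ∀ i → ⟦ i ⟧ℤ ≈ fromℤ i
  ⟦⟧ℤ≈fromℤ (+ n)    = sym (MultTCO.×ᵤ≈× +-monoid n 1#)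
  ⟦⟧ℤ≈fromℤ -[1+ n ] = -‿cong (sym (MultTCO.×ᵤ≈× +-monoid (suc n) 1#))

  solverMorphism : CommutativeRing.rawRing ℤ.+-*-commutativeRing -Raw-AlmostCommutative⟶ fromCommutativeRing commutativeRing
  solverMorphism = record
    { ⟦_⟧    = ⟦_⟧ℤ
    ; +-homo = λ i j → trans (⟦⟧ℤ≈fromℤ (i ℤ.+ j))
        (trans (fromℤ-+ i j) (sym (+-cong (⟦⟧ℤ≈fromℤ i) (⟦⟧ℤ≈fromℤ j))))
    ; *-homo = λ i j → trans (⟦⟧ℤ≈fromℤ (i ℤ.* j))
        (trans (fromℤ-* i j) (sym (*-cong (⟦⟧ℤ≈fromℤ i) (⟦⟧ℤ≈fromℤ j))))
    ; -‿homo = λ i → trans (⟦⟧ℤ≈fromℤ (ℤ.- i))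
        (trans (fromℤ-neg i) (-‿cong (sym (⟦⟧ℤ≈fromℤ i))))
    ; 0-homo = refl
    ; 1-homo = refl
    }

  _coeff≟_ : WeaklyDecidable (λ i j → ⟦ i ⟧ℤ ≈ ⟦ j ⟧ℤ)
  i coeff≟ j with i ℤ.≟ j
  ... | yes i≡j = just (reflexive (≡.cong ⟦_⟧ℤ i≡j))
  ... | no  _   = nothing

  open RingSolver (CommutativeRing.rawRing ℤ.+-*-commutativeRing) (fromCommutativeRing commutativeRing)
    solverMorphism _coeff≟_ public
    using (solve; _:=_; _:+_; _:*_; _:-_; :-_; con)

  -- Order

  open ToNonStrict _≈_ _<_ public using (_≤_; <⇒≤)

  strictPartialOrder : StrictPartialOrder c ℓ₁ ℓ₃
  strictPartialOrder = record { isStrictPartialOrder = isStrictPartialOrder }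

  module ≤-Reasoning = StrictReasoning strictPartialOrder

  ≤-refl : ∀ {x} → x ≤ x
  ≤-refl = inj₂ refl

  ≈⇒≤ : ∀ {x y} → x ≈ y → x ≤ y
  ≈⇒≤ = inj₂

  ≤-trans : ∀ {x y z} → x ≤ y → y ≤ z → x ≤ z
  ≤-trans = ToNonStrict.trans _≈_ _<_ isEquivalence <-resp-≈ <-trans

  +-monoˡ-≤ : ∀ z {x y} → x ≤ y → x + z ≤ y + z
  +-monoˡ-≤ z (inj₁ x<y) = inj₁ (+-monoˡ-< z x<y)
  +-monoˡ-≤ z (inj₂ x≈y) = inj₂ (+-congʳ x≈y)

  +-monoʳ-≤ : ∀ z {x y} → x ≤ y → z + x ≤ z + y
  +-monoʳ-≤ z {x} {y} x≤y = ≤-trans (≈⇒≤ (+-comm z x)) (≤-trans (+-monoˡ-≤ z x≤y) (≈⇒≤ (+-comm y z)))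

  +-mono-≤ : ∀ {x y u v} → x ≤ y → u ≤ v → x + u ≤ y + v
  +-mono-≤ {y = y} {u} x≤y u≤v = ≤-trans (+-monoˡ-≤ u x≤y) (+-monoʳ-≤ y u≤v)

  0≤+ : ∀ {x y} → 0# ≤ x → 0# ≤ y → 0# ≤ x + y
  0≤+ 0≤x 0≤y = ≤-trans (≈⇒≤ (sym (+-identityˡ 0#))) (+-mono-≤ 0≤x 0≤y)

  x≤x+y : ∀ x {y} → 0# ≤ y → x ≤ x + y
  x≤x+y x 0≤y = ≤-trans (≈⇒≤ (sym (+-identityʳ x))) (+-monoʳ-≤ x 0≤y)

  x≤y+x : ∀ x {y} → 0# ≤ y → x ≤ y + x
  x≤y+x x 0≤y = ≤-trans (≈⇒≤ (sym (+-identityˡ x))) (+-monoˡ-≤ x 0≤y)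

  *-monoˡ-< : ∀ {z x y} → 0# < z → x < y → z * x < z * y
  *-monoˡ-< {z} {x} {y} 0<z x<y = <-respˡ-≈ (+-identityˡ _) (<-respʳ-≈ eq
    (+-monoˡ-< (z * x) (*-pos 0<z (x<y⇒0<y-x x<y))))
    where
    eq : z * (y - x) + z * x ≈ z * y
    eq = solve 3 (λ z x y → z :* (y :- x) :+ z :* x := z :* y) refl z x y

  *-monoˡ-≤ : ∀ {z x y} → 0# ≤ z → x ≤ y → z * x ≤ z * y
  *-monoˡ-≤ (inj₁ 0<z) (inj₁ x<y) = inj₁ (*-monoˡ-< 0<z x<y)
  *-monoˡ-≤ {x = x} {y} (inj₂ 0≈z) _ = ≈⇒≤
    (trans (*-congʳ (sym 0≈z)) (trans (zeroˡ x) (trans (sym (zeroˡ y)) (*-congʳ 0≈z))))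
  *-monoˡ-≤ (inj₁ _) (inj₂ x≈y) = inj₂ (*-congˡ x≈y)

  0≤* : ∀ {x y} → 0# ≤ x → 0# ≤ y → 0# ≤ x * y
  0≤* {x} 0≤x 0≤y = ≤-trans (≈⇒≤ (sym (zeroʳ x))) (*-monoˡ-≤ 0≤x 0≤y)

  -- The sign of y cannot simply be decided, but -x inverts 0 - y, so y is apart from 0 and hence
  -- comparable with it; y < 0 would give 1 < 0.
  inverse-pos : ∀ {x y} → 0# < x → x * y ≈ 1# → 0# < y
  inverse-pos {x} {y} 0<x xy≈1 with #⇒<⊎> (invertible⇒# {0#} {y} (- x , left , trans (*-comm _ _) left))
    where
    left : - x * (0# - y) ≈ 1#
    left = trans (solve 2 (λ x y → :- x :* (con (+ 0) :- y) := x :* y) refl x y) xy≈1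
  ... | inj₁ 0<y = 0<y
  ... | inj₂ y<0 = ⊥-elim (<-asym 0<1 (<-respˡ-≈ xy≈1 (<-respʳ-≈ (zeroʳ x) (*-monoˡ-< 0<x y<0))))

  inverse-cancelˡ : ∀ {z z⁻¹} x → z * z⁻¹ ≈ 1# → z⁻¹ * (z * x) ≈ x
  inverse-cancelˡ {z} {z⁻¹} x zz⁻¹≈1 = begin
    z⁻¹ * (z * x)  ≈⟨ *-assoc z⁻¹ z x ⟨
    z⁻¹ * z * x    ≈⟨ *-congʳ (trans (*-comm z⁻¹ z) zz⁻¹≈1) ⟩
    1# * x         ≈⟨ *-identityˡ x ⟩
    x              ∎

  *-cancelˡ-≈ : ∀ {z x y} → 0# < z → z * x ≈ z * y → x ≈ y
  *-cancelˡ-≈ {x = x} {y} 0<z eq with z⁻¹ , zz⁻¹≈1 ← pos⇒inverse 0<z =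
    trans (sym (inverse-cancelˡ x zz⁻¹≈1)) (trans (*-congˡ eq) (inverse-cancelˡ y zz⁻¹≈1))

  *-cancelˡ-< : ∀ {z x y} → 0# < z → z * x < z * y → x < y
  *-cancelˡ-< {x = x} {y} 0<z zx<zy with z⁻¹ , zz⁻¹≈1 ← pos⇒inverse 0<z =
    <-respˡ-≈ (inverse-cancelˡ x zz⁻¹≈1) (<-respʳ-≈ (inverse-cancelˡ y zz⁻¹≈1)
      (*-monoˡ-< (inverse-pos 0<z zz⁻¹≈1) zx<zy))

  *-cancelˡ-≤ : ∀ {z x y} → 0# < z → z * x ≤ z * y → x ≤ y
  *-cancelˡ-≤ 0<z (inj₁ zx<zy) = inj₁ (*-cancelˡ-< 0<z zx<zy)
  *-cancelˡ-≤ 0<z (inj₂ zx≈zy) = inj₂ (*-cancelˡ-≈ 0<z zx≈zy)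

  y*[x/y]≈x : ∀ x {y} (0<y : 0# < y) → y * (x / y [ 0<y ]) ≈ x
  y*[x/y]≈x x {y} 0<y = begin
    y * (x * y⁻¹)  ≈⟨ solve 3 (λ x y z → y :* (x :* z) := x :* (y :* z)) refl x y y⁻¹ ⟩
    x * (y * y⁻¹)  ≈⟨ *-congˡ (proj₂ (pos⇒inverse 0<y)) ⟩
    x * 1#         ≈⟨ *-identityʳ x ⟩
    x              ∎
    where y⁻¹ = proj₁ (pos⇒inverse 0<y)

  0≤fromℕ : ∀ n → 0# ≤ fromℕ n
  0≤fromℕ zero    = ≤-refl
  0≤fromℕ (suc n) = 0≤+ (<⇒≤ 0<1) (0≤fromℕ n)

  0<fromℕ-suc : ∀ n → 0# < fromℕ (suc n)
  0<fromℕ-suc n = ToNonStrict.<-≤-trans _≈_ _<_ <-trans <-respʳ-≈ 0<1 (x≤x+y 1# (0≤fromℕ n))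

  fromℕ-mono-≤ : ∀ {m n} → m ℕ.≤ n → fromℕ m ≤ fromℕ n
  fromℕ-mono-≤ {n = n} z≤n = 0≤fromℕ n
  fromℕ-mono-≤ (s≤s m≤n)   = +-monoʳ-≤ 1# (fromℕ-mono-≤ m≤n)

  0≤^ : ∀ {x} n → 0# ≤ x → 0# ≤ x ^ n
  0≤^ zero    0≤x = <⇒≤ 0<1
  0≤^ (suc n) 0≤x = 0≤* 0≤x (0≤^ n 0≤x)

  -- Finite sums

  Σ : (ℕ → Carrier) → ℕ → Carrier
  Σ f zero    = 0#
  Σ f (suc N) = f 0 + Σ (f ∘ suc) N

  ∑≡Σ : ∀ f N → ∑[ m < N ] f (toℕ m) ≡ Σ f N
  ∑≡Σ f zero    = ≡.refl
  ∑≡Σ f (suc N) = ≡.cong (λ s → f 0 + s) (∑≡Σ (f ∘ suc) N)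

  Σ-cong-< : ∀ {f g} N → (∀ m → m ℕ.< N → f m ≈ g m) → Σ f N ≈ Σ g N
  Σ-cong-< zero    f≈g = refl
  Σ-cong-< (suc N) f≈g = +-cong (f≈g 0 (s≤s z≤n)) (Σ-cong-< N (λ m m<N → f≈g (suc m) (s≤s m<N)))

  Σ-cong : ∀ {f g} N → (∀ m → f m ≈ g m) → Σ f N ≈ Σ g N
  Σ-cong N f≈g = Σ-cong-< N (λ m _ → f≈g m)

  Σ-0 : ∀ {f} N → (∀ m → f m ≈ 0#) → Σ f N ≈ 0#
  Σ-0 zero    f≈0 = refl
  Σ-0 (suc N) f≈0 = trans (+-cong (f≈0 0) (Σ-0 N (f≈0 ∘ suc))) (+-identityˡ 0#)

  Σ-+ : ∀ f g N → Σ (λ m → f m + g m) N ≈ Σ f N + Σ g N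
  Σ-+ f g zero    = sym (+-identityˡ 0#)
  Σ-+ f g (suc N) = trans (+-congˡ (Σ-+ (f ∘ suc) (g ∘ suc) N))
    (solve 4 (λ x y s t → x :+ y :+ (s :+ t) := x :+ s :+ (y :+ t)) refl (f 0) (g 0) (Σ (f ∘ suc) N) (Σ (g ∘ suc) N))

  *-Σ : ∀ x f N → x * Σ f N ≈ Σ (λ m → x * f m) N
  *-Σ x f zero    = zeroʳ x
  *-Σ x f (suc N) = trans (distribˡ x _ _) (+-congˡ (*-Σ x (f ∘ suc) N))

  Σ-comm : ∀ (f : ℕ → ℕ → Carrier) M N → Σ (λ i → Σ (f i) N) M ≈ Σ (λ j → Σ (λ i → f i j) M) N
  Σ-comm f zero    N = sym (Σ-0 N (λ _ → refl))
  Σ-comm f (suc M) N = trans (+-congˡ (Σ-comm (f ∘ suc) M N)) (sym (Σ-+ (f 0) _ N))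

  Σ-last : ∀ f N → Σ f (suc N) ≈ Σ f N + f N
  Σ-last f zero    = +-comm _ _
  Σ-last f (suc N) = trans (+-congˡ (Σ-last (f ∘ suc) N)) (sym (+-assoc _ _ _))

  0≤Σ : ∀ {f} N → (∀ m → 0# ≤ f m) → 0# ≤ Σ f N
  0≤Σ zero    0≤f = ≤-refl
  0≤Σ (suc N) 0≤f = 0≤+ (0≤f 0) (0≤Σ N (0≤f ∘ suc))

  ·≈fromℕ-* : ∀ n x → n · x ≈ fromℕ n * x
  ·≈fromℕ-* n x = trans (sym (×-congʳ n (*-identityˡ x))) (sym (×-assoc-* n 1# x))

  binomialTheorem : ∀ n x y → (x + y) ^ n ≈ Σ (λ j → fromℕ (n C j) * (x ^ j * y ^ (n ∸ j))) (suc n)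
  binomialTheorem n x y = begin
    (x + y) ^ n                                             ≈⟨ Binomial.theorem commutativeSemiring n x y ⟩
    ∑[ j < suc n ] ((n C toℕ j) · term (toℕ j))             ≡⟨ ∑≡Σ (λ j → (n C j) · term j) (suc n) ⟩
    Σ (λ j → (n C j) · term j) (suc n)                      ≈⟨ Σ-cong {λ j → (n C j) · term j} {λ j → fromℕ (n C j) * term j} (suc n) (λ j → ·≈fromℕ-* (n C j) (term j)) ⟩
    Σ (λ j → fromℕ (n C j) * term j) (suc n)                ∎
    where
    term : ℕ → Carrier
    term j = x ^ j * y ^ (n ∸ j)

  -- Nonnegative bounded sequences and limits

  -- The lower bound 0 is part of the notion so that the closure properties carry sign and size
  -- together; `bounded⇒⟶` needs both.
  Bounded : (ℕ → Carrier) → Set (c ⊔ ℓ₁ ⊔ ℓ₃)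
  Bounded f = ∃ λ B → ∀ N → (0# ≤ f N) × (f N ≤ B)

  bounded-cong : ∀ {f g} → (∀ N → f N ≈ g N) → Bounded f → Bounded g
  bounded-cong f≈g (B , bound) = B , λ N →
    ≤-trans (proj₁ (bound N)) (≈⇒≤ (f≈g N)) , ≤-trans (≈⇒≤ (sym (f≈g N))) (proj₂ (bound N))

  bounded-const : ∀ {x} → 0# ≤ x → Bounded (λ _ → x)
  bounded-const {x} 0≤x = x , λ _ → 0≤x , ≤-refl

  bounded-+ : ∀ {f g} → Bounded f → Bounded g → Bounded (λ N → f N + g N)
  bounded-+ (B , bound) (B′ , bound′) = B + B′ , λ N →
    0≤+ (proj₁ (bound N)) (proj₁ (bound′ N)) , +-mono-≤ (proj₂ (bound N)) (proj₂ (bound′ N))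

  bounded-* : ∀ {x f} → 0# ≤ x → Bounded f → Bounded (λ N → x * f N)
  bounded-* {x} 0≤x (B , bound) = x * B , λ N →
    0≤* 0≤x (proj₁ (bound N)) , *-monoˡ-≤ 0≤x (proj₂ (bound N))

  bounded-Σ : ∀ {f : ℕ → ℕ → Carrier} n → (∀ j → j ℕ.< n → Bounded (f j)) → Bounded (λ N → Σ (λ j → f j N) n)
  bounded-Σ zero    _       = bounded-const ≤-refl
  bounded-Σ (suc n) bounded = bounded-+ (bounded 0 (s≤s z≤n)) (bounded-Σ n (λ j j<n → bounded (suc j) (s≤s j<n)))

  bounded-≤ : ∀ {f g} → (∀ N → 0# ≤ f N) → (∀ N → f N ≤ g N) → Bounded g → Bounded f
  bounded-≤ 0≤f f≤g (B , bound) = B , λ N → 0≤f N , ≤-trans (f≤g N) (proj₂ (bound N))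

  bounded-cancel : ∀ {x f} → 0# < x → Bounded (λ N → x * f N) → Bounded f
  bounded-cancel {x} {f} 0<x (B , bound) with x⁻¹ , xx⁻¹≈1 ← pos⇒inverse 0<x =
    bounded-cong (λ N → inverse-cancelˡ (f N) xx⁻¹≈1)
      (bounded-* (<⇒≤ (inverse-pos 0<x xx⁻¹≈1)) (B , bound))

  -- Apartness is tight, so it is enough to refute each strict order of the two limits. With half
  -- their distance as ε, a term far enough out lies strictly on both sides of the midpoint.
  ⟶-unique : ∀ {a l l′} → a ⟶ l → a ⟶ l′ → l ≈ l′
  ⟶-unique a⟶l a⟶l′ = proj₁ (tight _ _) λ l#l′ → apart a⟶l a⟶l′ (#⇒<⊎> l#l′)
    where
    ordered : ∀ {a l l′} → a ⟶ l → a ⟶ l′ → ¬ l < l′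
    ordered {a} {l} {l′} a⟶l a⟶l′ l<l′ = <-irrefl refl x<x
      where
      0<2 : 0# < 1# + 1#
      0<2 = <-trans 0<1 (<-respˡ-≈ (+-identityˡ 1#) (+-monoˡ-< 1# 0<1))
      half : ∃ λ h → (1# + 1#) * h ≈ 1#
      half = pos⇒inverse 0<2
      ε = proj₁ half * (l′ - l)
      0<ε : 0# < ε
      0<ε = *-pos (inverse-pos 0<2 (proj₂ half)) (x<y⇒0<y-x l<l′)
      N  = proj₁ (a⟶l ε 0<ε)
      N′ = proj₁ (a⟶l′ ε 0<ε)
      x = a (N ℕ.⊔ N′)
      above : x - l < ε
      above = proj₂ (proj₂ (a⟶l ε 0<ε) (N ℕ.⊔ N′) (ℕ.m≤m⊔n N N′))
      below : - ε < x - l′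
      below = proj₁ (proj₂ (a⟶l′ ε 0<ε) (N ℕ.⊔ N′) (ℕ.m≤n⊔m N N′))
      2ε≈l′-l : ε + ε ≈ l′ - l
      2ε≈l′-l = begin
        ε + ε                                  ≈⟨ solve 2 (λ h d → h :* d :+ h :* d := (con (+ 1) :+ con (+ 1)) :* h :* d) refl (proj₁ half) (l′ - l) ⟩
        (1# + 1#) * proj₁ half * (l′ - l)      ≈⟨ *-congʳ (proj₂ half) ⟩
        1# * (l′ - l)                          ≈⟨ *-identityˡ _ ⟩
        l′ - l                                 ∎
      l′-ε≈l+ε : - ε + l′ ≈ ε + l
      l′-ε≈l+ε = begin
        - ε + l′               ≈⟨ solve 3 (λ e l l′ → :- e :+ l′ := :- e :+ (l′ :- l :+ l)) refl ε l l′ ⟩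
        - ε + (l′ - l + l)     ≈⟨ +-congˡ (+-congʳ 2ε≈l′-l) ⟨
        - ε + (ε + ε + l)      ≈⟨ solve 2 (λ e l → :- e :+ (e :+ e :+ l) := e :+ l) refl ε l ⟩
        ε + l                  ∎
      x<x : x < x
      x<x = <-trans
        (<-respˡ-≈ (solve 2 (λ x l → (x :- l) :+ l := x) refl x l) (+-monoˡ-< l above))
        (<-respˡ-≈ l′-ε≈l+ε
          (<-respʳ-≈ (solve 2 (λ x l → (x :- l) :+ l := x) refl x l′) (+-monoˡ-< l′ below)))
    apart : ∀ {a l l′} → a ⟶ l → a ⟶ l′ → ¬ (l < l′ ⊎ l′ < l)
    apart a⟶l a⟶l′ (inj₁ l<l′) = ordered a⟶l a⟶l′ l<l′
    apart a⟶l a⟶l′ (inj₂ l′<l) = ordered a⟶l′ a⟶l l′<l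

  -- The Archimedean axiom supplies n with B < n ε; beyond n, the bound N (l - a N) ≤ B forces l - a
  -- N < ε.
  bounded⇒⟶ : ∀ {a l} → Bounded (λ N → fromℕ N * (l - a N)) → a ⟶ l
  -- Starting at `suc n` makes N positive, so that `fromℕ N` can be cancelled; at N = 0 the
  -- hypothesis carries no information about the error.
  bounded⇒⟶ {a} {l} (B , bound) ε 0<ε = suc n , close
    where
    ε⁻¹ = proj₁ (pos⇒inverse 0<ε)
    n   = proj₁ (archimedean (B * ε⁻¹))
    B<nε : B < fromℕ n * ε
    B<nε = <-respˡ-≈ (trans (solve 3 (λ e b e′ → e :* (b :* e′) := b :* (e :* e′)) refl ε B ε⁻¹)
        (trans (*-congˡ (proj₂ (pos⇒inverse 0<ε))) (*-identityʳ B)))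
      (<-respʳ-≈ (*-comm ε _) (*-monoˡ-< 0<ε (proj₂ (archimedean (B * ε⁻¹)))))
    close : ∀ N → suc n ℕ.≤ N → (- ε < a N - l) × (a N - l < ε)
    close (suc N) (s≤s n≤N) =
      <-respˡ-≈ (solve 2 (λ e d → d :+ (:- e :- d) := :- e) refl ε d)
        (<-respʳ-≈ (solve 3 (λ e l a → e :+ (:- e :- (l :- a)) := a :- l) refl ε l (a (suc N)))
          (+-monoˡ-< (- ε - d) d<ε)) ,
      (≤-Reasoning.begin-strict
        a (suc N) - l      ≤-Reasoning.≤⟨ x≤x+y _ 0≤d ⟩
        a (suc N) - l + d  ≤-Reasoning.≈⟨ solve 2 (λ l a → a :- l :+ (l :- a) := con (+ 0)) refl l (a (suc N)) ⟩
        0#                 ≤-Reasoning.<⟨ 0<ε ⟩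
        ε                  ≤-Reasoning.∎)
      where
      d = l - a (suc N)
      0≤d : 0# ≤ d
      0≤d = *-cancelˡ-≤ (0<fromℕ-suc N) (≤-trans (≈⇒≤ (zeroʳ _)) (proj₁ (bound (suc N))))
      d<ε : d < ε
      d<ε = *-cancelˡ-< (0<fromℕ-suc N) (≤-Reasoning.begin-strict
        fromℕ (suc N) * d  ≤-Reasoning.≤⟨ proj₂ (bound (suc N)) ⟩
        B                  ≤-Reasoning.<⟨ B<nε ⟩
        fromℕ n * ε        ≤-Reasoning.≈⟨ *-comm _ ε ⟩
        ε * fromℕ n        ≤-Reasoning.≤⟨ *-monoˡ-≤ (<⇒≤ 0<ε) (fromℕ-mono-≤ (ℕ.m≤n⇒m≤1+n n≤N)) ⟩
        ε * fromℕ (suc N)  ≤-Reasoning.≈⟨ *-comm ε _ ⟩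
        fromℕ (suc N) * ε  ≤-Reasoning.∎)

-- Eulerian polynomials with a parameter κ

module EulerianPolynomials {c ℓ₁ ℓ₂ ℓ₃} (F : ArchimedeanOrderedField c ℓ₁ ℓ₂ ℓ₃) where
  open OrderedField F
  open SetoidReasoning setoid

  -- Both recurrences of the paper at once: κ = k + 1 gives eᵏ, and κ = 0
  -- gives e.
  G : Carrier → ℕ → ℕ → Carrier
  G κ zero    zero    = 1#
  G κ zero    (suc i) = 0#
  G κ (suc n) zero    = κ * G κ n zero
  G κ (suc n) (suc i) =
    (κ + fromℕ (suc i)) * G κ n (suc i) + (fromℕ (suc n) - κ - fromℕ i) * G κ n i

  -- `G` has no guard for i > n: its recurrence produces the zeros by itself, in agreement with the
  -- guards of `eulerian` and `eulerianᵏ`.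
  G-vanishes : ∀ κ {n i} → n ℕ.< i → G κ n i ≈ 0#
  G-vanishes κ {zero}  {suc i} _         = refl
  G-vanishes κ {suc n} {suc i} (s≤s n<i) = begin
    x * G κ n (suc i) + y * G κ n i  ≈⟨ +-cong (*-congˡ (G-vanishes κ (ℕ.m<n⇒m<1+n n<i))) (*-congˡ (G-vanishes κ n<i)) ⟩
    x * 0# + y * 0#                  ≈⟨ solve 2 (λ x y → x :* con (+ 0) :+ y :* con (+ 0) := con (+ 0)) refl x y ⟩
    0#                               ∎
    where
    x = κ + fromℕ (suc i)
    y = fromℕ (suc n) - κ - fromℕ i

  fromℤ-linear : ∀ x a y b → fromℤ (x ℤ.* a ℤ.+ y ℤ.* b) ≈ fromℤ x * fromℤ a + fromℤ y * fromℤ b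
  fromℤ-linear x a y b = trans (fromℤ-+ (x ℤ.* a) (y ℤ.* b)) (+-cong (fromℤ-* x a) (fromℤ-* y b))

  fromℤ-- : ∀ x y → fromℤ (x ℤ.- y) ≈ fromℤ x - fromℤ y
  fromℤ-- x y = trans (fromℤ-+ x (ℤ.- y)) (+-congˡ (fromℤ-neg y))

  fromℤ-guarded : ∀ {A : Set} (A? : Dec A) {i x} → (A → x ≈ 0#) → fromℤ i ≈ x →
    fromℤ (if does A? then + 0 else i) ≈ x
  fromℤ-guarded (yes a) x≈0 _   = sym (x≈0 a)
  fromℤ-guarded (no _)  _   i≈x = i≈x

  fromℤ-eulerian : ∀ n i → fromℤ (eulerian n (+ i)) ≈ G 0# n i
  fromℤ-eulerian zero    zero    = +-identityʳ 1#
  fromℤ-eulerian zero    (suc i) = refl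
  -- The convention that the entry at index 0 vanishes for positive n is the factor κ = 0 in `G`.
  fromℤ-eulerian (suc n) zero    = sym (zeroˡ _)
  fromℤ-eulerian (suc n) (suc i) = fromℤ-guarded (+ suc n ℤ.<? + suc i)
    (λ n<i → G-vanishes 0# (ℤ.drop‿+<+ n<i)) (begin
    fromℤ (+ suc i ℤ.* eulerian n (+ suc i) ℤ.+ (+ suc n ℤ.- + suc i ℤ.+ + 1) ℤ.* eulerian n (+ i))
      ≈⟨ fromℤ-linear (+ suc i) (eulerian n (+ suc i)) (+ suc n ℤ.- + suc i ℤ.+ + 1) (eulerian n (+ i)) ⟩
    fromℕ (suc i) * fromℤ (eulerian n (+ suc i)) + fromℤ (+ suc n ℤ.- + suc i ℤ.+ + 1) * fromℤ (eulerian n (+ i))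
      ≈⟨ +-cong (*-cong (sym (+-identityˡ _)) (fromℤ-eulerian n (suc i))) (*-cong coefficient (fromℤ-eulerian n i)) ⟩
    G 0# (suc n) (suc i) ∎)
    where
    coefficient : fromℤ (+ suc n ℤ.- + suc i ℤ.+ + 1) ≈ fromℕ (suc n) - 0# - fromℕ i
    coefficient = begin
      fromℤ (+ suc n ℤ.- + suc i ℤ.+ + 1)               ≈⟨ fromℤ-+ (+ suc n ℤ.- + suc i) (+ 1) ⟩
      fromℤ (+ suc n ℤ.- + suc i) + (1# + 0#)           ≈⟨ +-congʳ (fromℤ-- (+ suc n) (+ suc i)) ⟩
      fromℕ (suc n) - (1# + fromℕ i) + (1# + 0#)
        ≈⟨ solve 2 (λ n i → n :- (con (+ 1) :+ i) :+ (con (+ 1) :+ con (+ 0)) := n :- con (+ 0) :- i) refl (fromℕ (suc n)) (fromℕ i) ⟩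
      fromℕ (suc n) - 0# - fromℕ i                      ∎

  -- At i = 0 the recurrence reads the entry at index -1, a term absent from `G`.
  eulerianᵏ-negative : ∀ k n i → eulerianᵏ k n -[1+ i ] ≡ + 0
  eulerianᵏ-negative k zero    i = ≡.refl
  eulerianᵏ-negative k (suc n) i = ≡.refl

  fromℤ-eulerianᵏ : ∀ k n i → fromℤ (eulerianᵏ k n (+ i)) ≈ G (1# + fromℤ k) n i
  fromℤ-eulerianᵏ k zero    zero    = +-identityʳ 1#
  fromℤ-eulerianᵏ k zero    (suc i) = refl
  fromℤ-eulerianᵏ k (suc n) zero    = begin
    fromℤ (x ℤ.* eulerianᵏ k n (+ 0) ℤ.+ y ℤ.* eulerianᵏ k n -[1+ 0 ])
      ≈⟨ fromℤ-linear x _ y _ ⟩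
    fromℤ x * fromℤ (eulerianᵏ k n (+ 0)) + fromℤ y * fromℤ (eulerianᵏ k n -[1+ 0 ])
      ≈⟨ +-cong (*-cong coefficient (fromℤ-eulerianᵏ k n 0)) (*-congˡ (reflexive (≡.cong fromℤ (eulerianᵏ-negative k n 0)))) ⟩
    (1# + fromℤ k) * G (1# + fromℤ k) n 0 + fromℤ y * 0#
      ≈⟨ trans (+-congˡ (zeroʳ _)) (+-identityʳ _) ⟩
    G (1# + fromℤ k) (suc n) 0 ∎
    where
    x = k ℤ.+ + 0 ℤ.+ + 1
    y = + suc n ℤ.- k ℤ.- + 0
    coefficient : fromℤ x ≈ 1# + fromℤ k
    coefficient = begin
      fromℤ x                       ≈⟨ trans (fromℤ-+ (k ℤ.+ + 0) (+ 1)) (+-congʳ (fromℤ-+ k (+ 0))) ⟩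
      fromℤ k + 0# + (1# + 0#)      ≈⟨ solve 1 (λ k → k :+ con (+ 0) :+ (con (+ 1) :+ con (+ 0)) := con (+ 1) :+ k) refl (fromℤ k) ⟩
      1# + fromℤ k                  ∎
  fromℤ-eulerianᵏ k (suc n) (suc i) = fromℤ-guarded (+ suc n ℤ.<? + suc i)
    (λ n<i → G-vanishes (1# + fromℤ k) (ℤ.drop‿+<+ n<i)) (begin
    fromℤ (x ℤ.* eulerianᵏ k n (+ suc i) ℤ.+ y ℤ.* eulerianᵏ k n (+ i))
      ≈⟨ fromℤ-linear x _ y _ ⟩
    fromℤ x * fromℤ (eulerianᵏ k n (+ suc i)) + fromℤ y * fromℤ (eulerianᵏ k n (+ i))
      ≈⟨ +-cong (*-cong coefficient₁ (fromℤ-eulerianᵏ k n (suc i))) (*-cong coefficient₂ (fromℤ-eulerianᵏ k n i)) ⟩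
    G (1# + fromℤ k) (suc n) (suc i) ∎)
    where
    x = k ℤ.+ + suc i ℤ.+ + 1
    y = + suc n ℤ.- k ℤ.- + suc i
    coefficient₁ : fromℤ x ≈ 1# + fromℤ k + fromℕ (suc i)
    coefficient₁ = begin
      fromℤ x                                ≈⟨ trans (fromℤ-+ (k ℤ.+ + suc i) (+ 1)) (+-congʳ (fromℤ-+ k (+ suc i))) ⟩
      fromℤ k + fromℕ (suc i) + (1# + 0#)    ≈⟨ solve 2 (λ k i → k :+ i :+ (con (+ 1) :+ con (+ 0)) := con (+ 1) :+ k :+ i) refl (fromℤ k) (fromℕ (suc i)) ⟩
      1# + fromℤ k + fromℕ (suc i)           ∎
    coefficient₂ : fromℤ y ≈ fromℕ (suc n) - (1# + fromℤ k) - fromℕ i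
    coefficient₂ = begin
      fromℤ y                                ≈⟨ trans (fromℤ-- (+ suc n ℤ.- k) (+ suc i)) (+-congʳ (fromℤ-- (+ suc n) k)) ⟩
      fromℕ (suc n) - fromℤ k - (1# + fromℕ i)
        ≈⟨ solve 3 (λ n k i → n :- k :- (con (+ 1) :+ i) := n :- (con (+ 1) :+ k) :- i) refl (fromℕ (suc n)) (fromℤ k) (fromℕ i) ⟩
      fromℕ (suc n) - (1# + fromℤ k) - fromℕ i  ∎

  -- The coefficients (-1)ⁱ C(m, i) of (1 - x)ᵐ.
  signedBinomial : ℕ → ℕ → Carrier
  signedBinomial zero    zero    = 1#
  signedBinomial zero    (suc i) = 0#
  signedBinomial (suc m) zero    = signedBinomial m zero
  signedBinomial (suc m) (suc i) = signedBinomial m (suc i) - signedBinomial m i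

  signedBinomial-vanishes : ∀ {m i} → m ℕ.< i → signedBinomial m i ≈ 0#
  signedBinomial-vanishes {zero}  {suc i} _         = refl
  signedBinomial-vanishes {suc m} {suc i} (s≤s m<i) =
    trans (+-cong (signedBinomial-vanishes (ℕ.m<n⇒m<1+n m<i)) (-‿cong (signedBinomial-vanishes m<i))) (-‿inverseʳ 0#)

  -- This is (i + 1) C(m, i + 1) = (m - i) C(m, i) with alternating signs. By Pascal's rule, an
  -- instance for m + 1 is a difference of two instances for m.
  signedBinomial-absorption : ∀ m i →
    fromℕ (suc i) * signedBinomial m (suc i) + (fromℕ m - fromℕ i) * signedBinomial m i ≈ 0#
  signedBinomial-absorption zero zero =
    solve 0 ((con (+ 1) :+ con (+ 0)) :* con (+ 0) :+ (con (+ 0) :- con (+ 0)) :* con (+ 1) := con (+ 0)) refl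
  signedBinomial-absorption zero (suc i) =
    solve 2 (λ x y → x :* con (+ 0) :+ y :* con (+ 0) := con (+ 0)) refl (fromℕ (suc (suc i))) (0# - fromℕ (suc i))
  signedBinomial-absorption (suc m) zero = begin
    (1# + 0#) * (b₁ - b₀) + (1# + fromℕ m - 0#) * b₀
      ≈⟨ solve 3 (λ m b₀ b₁ →
           (con (+ 1) :+ con (+ 0)) :* (b₁ :- b₀) :+ (con (+ 1) :+ m :- con (+ 0)) :* b₀ :=
           (con (+ 1) :+ con (+ 0)) :* b₁ :+ (m :- con (+ 0)) :* b₀) refl (fromℕ m) b₀ b₁ ⟩
    (1# + 0#) * b₁ + (fromℕ m - 0#) * b₀
      ≈⟨ signedBinomial-absorption m 0 ⟩
    0# ∎
    where
    b₀ = signedBinomial m 0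
    b₁ = signedBinomial m 1
  signedBinomial-absorption (suc m) (suc i) = begin
    (1# + (1# + fromℕ i)) * (b₂ - b₁) + (1# + fromℕ m - (1# + fromℕ i)) * (b₁ - b₀)
      ≈⟨ solve 5 (λ m i b₀ b₁ b₂ →
           (con (+ 1) :+ (con (+ 1) :+ i)) :* (b₂ :- b₁) :+ (con (+ 1) :+ m :- (con (+ 1) :+ i)) :* (b₁ :- b₀) :=
           (con (+ 1) :+ (con (+ 1) :+ i)) :* b₂ :+ (m :- (con (+ 1) :+ i)) :* b₁ :- ((con (+ 1) :+ i) :* b₁ :+ (m :- i) :* b₀))
           refl (fromℕ m) (fromℕ i) b₀ b₁ b₂ ⟩
    (1# + (1# + fromℕ i)) * b₂ + (fromℕ m - (1# + fromℕ i)) * b₁ - ((1# + fromℕ i) * b₁ + (fromℕ m - fromℕ i) * b₀)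
      ≈⟨ +-cong (signedBinomial-absorption m (suc i)) (-‿cong (signedBinomial-absorption m i)) ⟩
    0# - 0#
      ≈⟨ -‿inverseʳ 0# ⟩
    0# ∎
    where
    b₀ = signedBinomial m i
    b₁ = signedBinomial m (suc i)
    b₂ = signedBinomial m (suc (suc i))

  G-zero : ∀ κ m → G κ m 0 ≈ κ ^ m * signedBinomial (suc m) 0
  G-zero κ zero    = sym (*-identityʳ 1#)
  G-zero κ (suc m) = trans (*-congˡ (G-zero κ m)) (sym (*-assoc κ _ _))

  -- The coefficient of x^{i+1} in the identity that links κ and κ + 1; `G-zero` is the constant
  -- coefficient. Inserting the induction hypothesis into the recurrence for κ yields the recurrence
  -- for κ + 1 and the next signed binomial, with a surplus of κᵐ times `signedBinomial-absorption`.
  G-suc : ∀ κ m i → G κ m (suc i) ≈ G (1# + κ) m i + κ ^ m * signedBinomial (suc m) (suc i)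
  G-suc κ zero zero =
    solve 0 (con (+ 0) := con (+ 1) :+ con (+ 1) :* (con (+ 0) :- con (+ 1))) refl
  G-suc κ zero (suc i) =
    solve 0 (con (+ 0) := con (+ 0) :+ con (+ 1) :* (con (+ 0) :- con (+ 0))) refl
  G-suc κ (suc m) zero = begin
    (κ + (1# + 0#)) * G κ m 1 + (1# + fromℕ m - κ - 0#) * G κ m 0
      ≈⟨ +-cong (*-congˡ (G-suc κ m 0)) (*-congˡ (G-zero κ m)) ⟩
    (κ + (1# + 0#)) * (g + κ ^ m * b₁) + (1# + fromℕ m - κ - 0#) * (κ ^ m * b₀)
      ≈⟨ solve 6 (λ κ m c g b₀ b₁ →
           (κ :+ (con (+ 1) :+ con (+ 0))) :* (g :+ c :* b₁) :+ (con (+ 1) :+ m :- κ :- con (+ 0)) :* (c :* b₀) :=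
           (con (+ 1) :+ κ) :* g :+ κ :* c :* (b₁ :- b₀)
             :+ c :* ((con (+ 1) :+ con (+ 0)) :* b₁ :+ (con (+ 1) :+ m :- con (+ 0)) :* b₀))
           refl κ (fromℕ m) (κ ^ m) g b₀ b₁ ⟩
    (1# + κ) * g + κ ^ suc m * (b₁ - b₀) + κ ^ m * ((1# + 0#) * b₁ + (1# + fromℕ m - 0#) * b₀)
      ≈⟨ +-congˡ (trans (*-congˡ (signedBinomial-absorption (suc m) 0)) (zeroʳ _)) ⟩
    (1# + κ) * g + κ ^ suc m * (b₁ - b₀) + 0#
      ≈⟨ +-identityʳ _ ⟩
    (1# + κ) * g + κ ^ suc m * (b₁ - b₀) ∎
    where
    g  = G (1# + κ) m 0
    b₀ = signedBinomial (suc m) 0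
    b₁ = signedBinomial (suc m) 1
  G-suc κ (suc m) (suc i) = begin
    (κ + (1# + (1# + fromℕ i))) * G κ m (suc (suc i)) + (1# + fromℕ m - κ - (1# + fromℕ i)) * G κ m (suc i)
      ≈⟨ +-cong (*-congˡ (G-suc κ m (suc i))) (*-congˡ (G-suc κ m i)) ⟩
    (κ + (1# + (1# + fromℕ i))) * (g₁ + κ ^ m * b₂) + (1# + fromℕ m - κ - (1# + fromℕ i)) * (g₀ + κ ^ m * b₁)
      ≈⟨ solve 8 (λ κ m i c g₀ g₁ b₁ b₂ →
           (κ :+ (con (+ 1) :+ (con (+ 1) :+ i))) :* (g₁ :+ c :* b₂)
             :+ (con (+ 1) :+ m :- κ :- (con (+ 1) :+ i)) :* (g₀ :+ c :* b₁) :=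
           (con (+ 1) :+ κ :+ (con (+ 1) :+ i)) :* g₁ :+ (con (+ 1) :+ m :- (con (+ 1) :+ κ) :- i) :* g₀
             :+ κ :* c :* (b₂ :- b₁)
             :+ c :* ((con (+ 1) :+ (con (+ 1) :+ i)) :* b₂ :+ (con (+ 1) :+ m :- (con (+ 1) :+ i)) :* b₁))
           refl κ (fromℕ m) (fromℕ i) (κ ^ m) g₀ g₁ b₁ b₂ ⟩
    G (1# + κ) (suc m) (suc i) + κ ^ suc m * (b₂ - b₁)
      + κ ^ m * ((1# + (1# + fromℕ i)) * b₂ + (1# + fromℕ m - (1# + fromℕ i)) * b₁)
      ≈⟨ +-congˡ (trans (*-congˡ (signedBinomial-absorption (suc m) (suc i))) (zeroʳ _)) ⟩
    G (1# + κ) (suc m) (suc i) + κ ^ suc m * (b₂ - b₁) + 0#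
      ≈⟨ +-identityʳ _ ⟩
    G (1# + κ) (suc m) (suc i) + κ ^ suc m * (b₂ - b₁) ∎
    where
    g₀ = G (1# + κ) m i
    g₁ = G (1# + κ) m (suc i)
    b₁ = signedBinomial (suc m) (suc i)
    b₂ = signedBinomial (suc m) (suc (suc i))

  -- Evaluation at p and telescoping in κ

  module _ (p : Carrier) where

    evaluate : (ℕ → Carrier) → ℕ → Carrier
    evaluate f = Σ (λ i → f i * p ^ i)

    evaluate-extend : ∀ {f} M → f M ≈ 0# → evaluate f (suc M) ≈ evaluate f M
    evaluate-extend {f} M fM≈0 = trans (Σ-last (λ i → f i * p ^ i) M)
      (trans (+-congˡ (trans (*-congʳ fM≈0) (zeroˡ _))) (+-identityʳ _))

    -- The hypotheses say f = g + x h coefficientwise. The factor x uses up one index, so h is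
    -- summed over one term fewer.
    evaluate-shift : ∀ {f g h} M → f 0 ≈ g 0 → (∀ i → f (suc i) ≈ h i + g (suc i)) →
      evaluate f (suc M) ≈ evaluate g (suc M) + p * evaluate h M
    evaluate-shift {f} {g} {h} M f₀≈g₀ f≈h+g = begin
      f 0 * 1# + Σ (λ i → f (suc i) * p ^ suc i) M
        ≈⟨ +-cong (*-congʳ f₀≈g₀) (Σ-cong M (λ i → trans (*-congʳ (f≈h+g i))
             (solve 4 (λ h g p pⁱ → (h :+ g) :* (p :* pⁱ) := g :* (p :* pⁱ) :+ p :* (h :* pⁱ)) refl (h i) (g (suc i)) p (p ^ i)))) ⟩
      g 0 * 1# + Σ (λ i → g (suc i) * p ^ suc i + p * (h i * p ^ i)) M
        ≈⟨ +-congˡ (Σ-+ (λ i → g (suc i) * p ^ suc i) (λ i → p * (h i * p ^ i)) M) ⟩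
      g 0 * 1# + (Σ (λ i → g (suc i) * p ^ suc i) M + Σ (λ i → p * (h i * p ^ i)) M)
        ≈⟨ +-assoc _ _ _ ⟨
      evaluate g (suc M) + Σ (λ i → p * (h i * p ^ i)) M
        ≈⟨ +-congˡ (*-Σ p (λ i → h i * p ^ i) M) ⟨
      evaluate g (suc M) + p * evaluate h M ∎

    evaluate-* : ∀ x f M → evaluate (λ i → x * f i) M ≈ x * evaluate f M
    evaluate-* x f M = trans (Σ-cong M (λ i → *-assoc x (f i) (p ^ i))) (sym (*-Σ x (λ i → f i * p ^ i) M))

    evaluate-signedBinomial : ∀ {m M} → m ℕ.< M → evaluate (signedBinomial m) M ≈ (1# - p) ^ m
    evaluate-signedBinomial {zero} {suc M} _ =
      trans (+-cong (*-identityʳ 1#) (Σ-0 M (λ i → zeroˡ _))) (+-identityʳ 1#)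
    evaluate-signedBinomial {suc m} {suc M} (s≤s m<M) = begin
      evaluate (signedBinomial (suc m)) (suc M)
        -- Pascal's rule as (1 - x)^{m+1} = (1 - x)ᵐ - x (1 - x)ᵐ.
        ≈⟨ evaluate-shift {signedBinomial (suc m)} {signedBinomial m} {λ i → - 1# * signedBinomial m i} M refl (λ i →
             solve 2 (λ x y → x :- y := :- con (+ 1) :* y :+ x) refl (signedBinomial m (suc i)) (signedBinomial m i)) ⟩
      evaluate (signedBinomial m) (suc M) + p * evaluate (λ i → - 1# * signedBinomial m i) M
        ≈⟨ +-cong (evaluate-signedBinomial (ℕ.m<n⇒m<1+n m<M))
             (*-congˡ (trans (evaluate-* (- 1#) (signedBinomial m) M) (*-congˡ (evaluate-signedBinomial m<M)))) ⟩
      (1# - p) ^ m + p * (- 1# * (1# - p) ^ m)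
        ≈⟨ solve 2 (λ p c → c :+ p :* (:- con (+ 1) :* c) := (con (+ 1) :- p) :* c) refl p ((1# - p) ^ m) ⟩
      (1# - p) ^ suc m ∎

    evaluate-G : ∀ κ {m M} → m ℕ.< M →
      evaluate (G κ m) M ≈ κ ^ m * (1# - p) ^ suc m + p * evaluate (G (1# + κ) m) M
    evaluate-G κ {m} {M} m<M = begin
      -- The added zero coefficient pays for the term lost in the shift, so the same M serves on
      -- both sides and the identity can be iterated.
      evaluate (G κ m) M        ≈⟨ evaluate-extend {G κ m} M (G-vanishes κ m<M) ⟨
      evaluate (G κ m) (suc M)
        ≈⟨ evaluate-shift {G κ m} {λ i → κ ^ m * signedBinomial (suc m) i} {G (1# + κ) m} M (G-zero κ m) (G-suc κ m) ⟩
      evaluate (λ i → κ ^ m * signedBinomial (suc m) i) (suc M) + p * evaluate (G (1# + κ) m) M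
        ≈⟨ +-congʳ (trans (evaluate-* (κ ^ m) (signedBinomial (suc m)) (suc M)) (*-congˡ (evaluate-signedBinomial (s≤s m<M)))) ⟩
      κ ^ m * (1# - p) ^ suc m + p * evaluate (G (1# + κ) m) M ∎

    -- Each use of `evaluate-G` raises κ by one and contributes a factor p. `fromℕ (suc K)` is
    -- `1# + fromℕ K` by definition, so consecutive uses fit together.
    evaluate-G-telescope : ∀ K {m M} → m ℕ.< M →
      evaluate (G 0# m) M ≈ (1# - p) ^ suc m * Σ (λ i → fromℕ i ^ m * p ^ i) K + p ^ K * evaluate (G (fromℕ K) m) M
    evaluate-G-telescope zero {m} {M} _ =
      solve 2 (λ q e → e := q :* con (+ 0) :+ con (+ 1) :* e) refl ((1# - p) ^ suc m) (evaluate (G 0# m) M)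
    evaluate-G-telescope (suc K) {m} {M} m<M = begin
      evaluate (G 0# m) M
        ≈⟨ evaluate-G-telescope K m<M ⟩
      q * s + p ^ K * evaluate (G (fromℕ K) m) M
        ≈⟨ +-congˡ (*-congˡ (evaluate-G (fromℕ K) m<M)) ⟩
      q * s + p ^ K * (fromℕ K ^ m * q + p * e)
        ≈⟨ solve 6 (λ q s pᴷ c p e → q :* s :+ pᴷ :* (c :* q :+ p :* e) := q :* (s :+ c :* pᴷ) :+ p :* pᴷ :* e)
             refl q s (p ^ K) (fromℕ K ^ m) p e ⟩
      q * (s + fromℕ K ^ m * p ^ K) + p ^ suc K * e
        ≈⟨ +-congʳ (*-congˡ (Σ-last (λ i → fromℕ i ^ m * p ^ i) K)) ⟨
      q * Σ (λ i → fromℕ i ^ m * p ^ i) (suc K) + p ^ suc K * e ∎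
      where
      q = (1# - p) ^ suc m
      s = Σ (λ i → fromℕ i ^ m * p ^ i) K
      e = evaluate (G (fromℕ (suc K)) m) M

    eulerian-sum : ∀ k {m M} → 1 ℕ.≤ m → m ℕ.< M →
      Σ (λ i → fromℤ (eulerian m (+ i)) * p ^ i - fromℤ (eulerianᵏ (+ k) m (+ i)) * p ^ (k ℕ.+ i ℕ.+ 1)) M ≈
      (1# - p) ^ suc m * Σ (λ i → fromℕ (suc i) ^ m * p ^ suc i) k
    eulerian-sum k {suc m} {M} _ m<M = begin
      Σ (λ i → fromℤ (eulerian (suc m) (+ i)) * p ^ i - fromℤ (eulerianᵏ (+ k) (suc m) (+ i)) * p ^ (k ℕ.+ i ℕ.+ 1)) M
        ≈⟨ Σ-cong M (λ i → +-cong (*-congʳ (fromℤ-eulerian (suc m) i))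
             (trans (-‿cong (*-cong (fromℤ-eulerianᵏ (+ k) (suc m) i) (power i)))
               (solve 3 (λ g pᵏ pⁱ → :- (g :* (pᵏ :* pⁱ)) := :- pᵏ :* (g :* pⁱ)) refl (G (fromℕ (suc k)) (suc m) i) (p ^ suc k) (p ^ i)))) ⟩
      Σ (λ i → G 0# (suc m) i * p ^ i + - (p ^ suc k) * (G (fromℕ (suc k)) (suc m) i * p ^ i)) M
        ≈⟨ Σ-+ (λ i → G 0# (suc m) i * p ^ i) (λ i → - (p ^ suc k) * (G (fromℕ (suc k)) (suc m) i * p ^ i)) M ⟩
      evaluate (G 0# (suc m)) M + Σ (λ i → - (p ^ suc k) * (G (fromℕ (suc k)) (suc m) i * p ^ i)) M
        ≈⟨ +-cong (evaluate-G-telescope (suc k) m<M) (sym (*-Σ (- (p ^ suc k)) (λ i → G (fromℕ (suc k)) (suc m) i * p ^ i) M)) ⟩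
      -- After k + 1 steps from κ = 0 the surviving polynomial is exactly the subtracted one. The
      -- term i = 0 carries 0 to a positive power, which is where m ≥ 1 enters.
      q * (0# * 0# ^ m * 1# + s) + p ^ suc k * e + - (p ^ suc k) * e
        ≈⟨ solve 5 (λ q z s pᵏ e → q :* (con (+ 0) :* z :* con (+ 1) :+ s) :+ pᵏ :* e :+ :- pᵏ :* e := q :* s)
             refl q (0# ^ m) s (p ^ suc k) e ⟩
      q * s ∎
      where
      q = (1# - p) ^ suc (suc m)
      s = Σ (λ i → fromℕ (suc i) ^ suc m * p ^ suc i) k
      e = evaluate (G (fromℕ (suc k)) (suc m)) M
      power : ∀ i → p ^ (k ℕ.+ i ℕ.+ 1) ≈ p ^ suc k * p ^ i
      power i = trans (^-congʳ p (ℕ.+-comm (k ℕ.+ i) 1)) (^-homo-* p (suc k) i)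

-- Sequences of order 1/N and the boundary terms of truncated sums

module Vanishing {c ℓ₁ ℓ₂ ℓ₃} (F : ArchimedeanOrderedField c ℓ₁ ℓ₂ ℓ₃) where
  open OrderedField F
  open SetoidReasoning setoid

  -- Nonnegative (except possibly at 0) and O(1/N).
  Vanishing : (ℕ → Carrier) → Set (c ⊔ ℓ₁ ⊔ ℓ₃)
  Vanishing f = Bounded (λ N → fromℕ N * f N)

  vanishing-cong : ∀ {f g} → (∀ N → f N ≈ g N) → Vanishing f → Vanishing g
  vanishing-cong f≈g = bounded-cong (λ N → *-congˡ (f≈g N))

  vanishing-0 : Vanishing (λ _ → 0#)
  vanishing-0 = bounded-cong (λ N → sym (zeroʳ _)) (bounded-const ≤-refl)

  vanishing-+ : ∀ {f g} → Vanishing f → Vanishing g → Vanishing (λ N → f N + g N)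
  vanishing-+ vf vg = bounded-cong (λ N → sym (distribˡ _ _ _)) (bounded-+ vf vg)

  vanishing-* : ∀ {x f} → 0# ≤ x → Vanishing f → Vanishing (λ N → x * f N)
  vanishing-* {x} {f} 0≤x vf = bounded-cong
    (λ N → solve 3 (λ x n y → x :* (n :* y) := n :* (x :* y)) refl x (fromℕ N) (f N)) (bounded-* 0≤x vf)

  vanishing-Σ : ∀ {f : ℕ → ℕ → Carrier} n → (∀ j → j ℕ.< n → Vanishing (f j)) → Vanishing (λ N → Σ (λ j → f j N) n)
  vanishing-Σ {f} n vf = bounded-cong (λ N → sym (*-Σ (fromℕ N) (λ j → f j N) n)) (bounded-Σ n vf)

  vanishing-cancel : ∀ {x f} → 0# < x → Vanishing (λ N → x * f N) → Vanishing f
  vanishing-cancel {x} {f} 0<x vf = bounded-cancel 0<x (bounded-cong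
    (λ N → solve 3 (λ x n y → n :* (x :* y) := x :* (n :* y)) refl x (fromℕ N) (f N)) vf)

  -- The value 0 for the empty sum keeps `last f (N ∸ i)` harmless once the truncated difference
  -- reaches 0.
  last : (ℕ → Carrier) → ℕ → Carrier
  last f zero    = 0#
  last f (suc N) = f N

  -- The part of Σ f N that is lost when the last i terms are dropped.
  gap : ℕ → (ℕ → Carrier) → ℕ → Carrier
  gap zero    f N = 0#
  gap (suc i) f N = gap i f N + last f (N ∸ i)

  Σ-pred : ∀ f N → Σ f N ≈ Σ f (ℕ.pred N) + last f N
  Σ-pred f zero    = sym (+-identityʳ 0#)
  Σ-pred f (suc N) = Σ-last f N

  Σ-gap : ∀ i f N → Σ f N ≈ Σ f (N ∸ i) + gap i f N
  Σ-gap zero    f N = sym (+-identityʳ _)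
  Σ-gap (suc i) f N = begin
    Σ f N                                                 ≈⟨ Σ-gap i f N ⟩
    Σ f (N ∸ i) + gap i f N                               ≈⟨ +-congʳ (Σ-pred f (N ∸ i)) ⟩
    Σ f (ℕ.pred (N ∸ i)) + last f (N ∸ i) + gap i f N     ≡⟨ ≡.cong (λ M → Σ f M + last f (N ∸ i) + gap i f N) (ℕ.pred[m∸n]≡m∸[1+n] N i) ⟩
    Σ f (N ∸ suc i) + last f (N ∸ i) + gap i f N          ≈⟨ solve 3 (λ s l g → s :+ l :+ g := s :+ (g :+ l)) refl (Σ f (N ∸ suc i)) (last f (N ∸ i)) (gap i f N) ⟩
    Σ f (N ∸ suc i) + (gap i f N + last f (N ∸ i))        ∎

  0≤last : ∀ {f} → (∀ m → 0# ≤ f m) → ∀ N → 0# ≤ last f N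
  0≤last 0≤f zero    = ≤-refl
  0≤last 0≤f (suc N) = 0≤f N

  0≤gap : ∀ {f} → (∀ m → 0# ≤ f m) → ∀ i N → 0# ≤ gap i f N
  0≤gap 0≤f zero    N = ≤-refl
  0≤gap 0≤f (suc i) N = 0≤+ (0≤gap 0≤f i N) (0≤last 0≤f (N ∸ i))

  -- With N = M + (i + 1) one has N f(M) = M f(M) + (i + 1) f(M): decay bounds the first summand and
  -- boundedness the second.
  vanishing-last : ∀ {f} i → Bounded f → Vanishing f → Vanishing (λ N → last f (N ∸ i))
  vanishing-last {f} i (B , bound) (B′ , bound′) = B′ + fromℕ (suc i) * B , λ N → go N (N ∸ i) ≡.refl
    where
    0≤B : 0# ≤ B
    0≤B = ≤-trans (proj₁ (bound 0)) (proj₂ (bound 0))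
    0≤B′ : 0# ≤ B′
    0≤B′ = ≤-trans (proj₁ (bound′ 0)) (proj₂ (bound′ 0))
    go : ∀ N M → N ∸ i ≡ M →
      (0# ≤ fromℕ N * last f M) × (fromℕ N * last f M ≤ B′ + fromℕ (suc i) * B)
    go N zero    _  = ≈⇒≤ (sym (zeroʳ _)) ,
      ≤-trans (≈⇒≤ (zeroʳ _)) (0≤+ 0≤B′ (0≤* (0≤fromℕ (suc i)) 0≤B))
    go N (suc M) eq = 0≤* (0≤fromℕ N) (proj₁ (bound M)) ,
      ≤-trans (≈⇒≤ split) (+-mono-≤ (proj₂ (bound′ M)) (*-monoˡ-≤ (0≤fromℕ (suc i)) (proj₂ (bound M))))
      where
      N≡M+[1+i] : N ≡ M ℕ.+ suc i
      N≡M+[1+i] = ≡.trans (≡.sym (ℕ.m∸n+n≡m (ℕ.<⇒≤ (ℕ.m∸n≢0⇒n<m {N} {i} (λ N∸i≡0 → ℕ.1+n≢0 (≡.trans (≡.sym eq) N∸i≡0))))))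
        (≡.trans (≡.cong (ℕ._+ i) eq) (≡.sym (ℕ.+-suc M i)))
      split : fromℕ N * f M ≈ fromℕ M * f M + fromℕ (suc i) * f M
      split = trans (*-congʳ (trans (reflexive (≡.cong fromℕ N≡M+[1+i])) (fromℕ-+ M (suc i)))) (distribʳ _ _ _)

  vanishing-gap : ∀ {f} i → Bounded f → Vanishing f → Vanishing (gap i f)
  vanishing-gap zero    bf vf = vanishing-0
  vanishing-gap (suc i) bf vf = vanishing-+ (vanishing-gap i bf vf) (vanishing-last i bf vf)

  bounded-term : ∀ {f} → (∀ m → 0# ≤ f m) → Bounded (Σ f) → Bounded f
  bounded-term {f} 0≤f (B , bound) = B , λ N → 0≤f N ,
    ≤-trans (x≤y+x (f N) (0≤Σ N 0≤f)) (≤-trans (≈⇒≤ (sym (Σ-last f N))) (proj₂ (bound (suc N))))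

  -- The distribution of a waiting time delayed by i flips.
  shift : ℕ → (ℕ → Carrier) → ℕ → Carrier
  shift zero    f m       = f m
  shift (suc i) f zero    = 0#
  shift (suc i) f (suc m) = shift i f m

  Σ-shift : ∀ i f (h : ℕ → Carrier) N → Σ (λ m → h m * shift i f m) N ≈ Σ (λ m → h (i ℕ.+ m) * f m) (N ∸ i)
  Σ-shift zero    f h N       = refl
  Σ-shift (suc i) f h zero    = refl
  Σ-shift (suc i) f h (suc N) = trans (+-cong (zeroʳ _) (Σ-shift i f (h ∘ suc) N)) (+-identityˡ _)

  δ : ℕ → Carrier
  δ zero    = 1#
  δ (suc m) = 0#

  -- A nonempty sum already contains h 0; otherwise `δ M`, as the indicator of the empty sum,
  -- supplies it. This makes the identity valid for every M.
  Σ-δ : ∀ (h : ℕ → Carrier) M → Σ (λ m → h m * δ m) M + δ M * h 0 ≈ h 0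
  Σ-δ h zero    = trans (+-identityˡ _) (*-identityˡ _)
  Σ-δ h (suc M) = begin
    h 0 * 1# + Σ (λ m → h (suc m) * 0#) M + 0# * h 0  ≈⟨ +-congʳ (+-congˡ (Σ-0 M (λ m → zeroʳ _))) ⟩
    h 0 * 1# + 0# + 0# * h 0                          ≈⟨ solve 1 (λ x → x :* con (+ 1) :+ con (+ 0) :+ con (+ 0) :* x := x) refl (h 0) ⟩
    h 0                                               ∎

  0≤δ : ∀ m → 0# ≤ δ m
  0≤δ zero    = <⇒≤ 0<1
  0≤δ (suc m) = ≤-refl

  -- The sequence is nonzero only for N ≤ k, which explains the bound `fromℕ k`.
  vanishing-δ : ∀ k → Vanishing (λ N → δ (N ∸ k))
  vanishing-δ k = fromℕ k , λ N → 0≤* (0≤fromℕ N) (0≤δ (N ∸ k)) , go N (N ∸ k) ≡.refl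
    where
    go : ∀ N M → N ∸ k ≡ M → fromℕ N * δ M ≤ fromℕ k
    go N zero    eq = ≤-trans (≈⇒≤ (*-identityʳ _)) (fromℕ-mono-≤ (ℕ.m∸n≡0⇒m≤n {N} {k} eq))
    go N (suc M) _  = ≤-trans (≈⇒≤ (zeroʳ _)) (0≤fromℕ k)

-- The waiting time for k consecutive heads and its moments

module RunMoments {c ℓ₁ ℓ₂ ℓ₃} (F : ArchimedeanOrderedField c ℓ₁ ℓ₂ ℓ₃)
  (p : ArchimedeanOrderedField.Carrier F)
  (0<p : ArchimedeanOrderedField._<_ F (ArchimedeanOrderedField.0# F) p)
  (p<1 : ArchimedeanOrderedField._<_ F p (ArchimedeanOrderedField.1# F))
  (k : ℕ) where
  open OrderedField F
  open Vanishing F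
  open EulerianPolynomials F
  open CoinFlips F p k
  open SetoidReasoning setoid

  q : Carrier
  q = 1# - p

  0<q : 0# < q
  0<q = x<y⇒0<y-x p<1

  -- The distribution of Y

  -- With a Boolean test in place of a decision procedure, `firstAppears?` can be exchanged for
  -- `completes`, whose response to a first flip is definitional.
  weight : (List Coin → Bool) → List (List Coin) → Carrier
  weight f []       = 0#
  weight f (w ∷ ws) = (if f w then probability w else 0#) + weight f ws

  weight-filter : ∀ {P : List Coin → Set} (P? : ∀ w → Dec (P w)) f → (∀ w → does (P? w) ≡ f w) →
    ∀ ws → foldr _+_ 0# (map probability (filter P? ws)) ≈ weight f ws
  weight-filter P? f P?≡f []       = refl
  weight-filter P? f P?≡f (w ∷ ws) with does (P? w) | f w | P?≡f w
  ... | true  | true  | _ = +-congˡ (weight-filter P? f P?≡f ws)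
  ... | false | false | _ = trans (weight-filter P? f P?≡f ws) (sym (+-identityˡ _))

  weight-++ : ∀ f vs ws → weight f (vs ++ ws) ≈ weight f vs + weight f ws
  weight-++ f []       ws = sym (+-identityˡ _)
  weight-++ f (v ∷ vs) ws = trans (+-congˡ (weight-++ f vs ws)) (sym (+-assoc _ _ _))

  weight-map-∷ : ∀ f x ws → weight f (map (x ∷_) ws) ≈ flipProbability x * weight (f ∘ (x ∷_)) ws
  weight-map-∷ f x []       = sym (zeroʳ _)
  weight-map-∷ f x (w ∷ ws) = trans (+-cong (lemma (f (x ∷ w))) (weight-map-∷ f x ws)) (sym (distribˡ _ _ _))
    where
    lemma : ∀ b → (if b then probability (x ∷ w) else 0#) ≈ flipProbability x * (if b then probability w else 0#)
    lemma true  = refl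
    lemma false = sym (zeroʳ _)

  weight-false : ∀ ws → weight (λ _ → false) ws ≈ 0#
  weight-false []       = refl
  weight-false (w ∷ ws) = trans (+-identityˡ _) (weight-false ws)

  weight-outcomes : ∀ f m → weight f (outcomes (suc m)) ≈
    p * weight (f ∘ (H ∷_)) (outcomes m) + q * weight (f ∘ (T ∷_)) (outcomes m)
  weight-outcomes f m = trans (weight-++ f (map (H ∷_) (outcomes m)) _)
    (+-cong (weight-map-∷ f H (outcomes m))
      (trans (weight-++ f (map (T ∷_) (outcomes m)) [])
        (trans (+-identityʳ _) (weight-map-∷ f T (outcomes m)))))

  -- The probability that exactly m more flips are needed when r heads are
  -- still missing from the current run.
  waiting : ℕ → ℕ → Carrier
  waiting r m = weight (completes k r) (outcomes m)

  P : ℕ → Carrier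
  P = waiting k

  P[Y≡]≈P : ∀ m → P[Y≡ m ] ≈ P m
  P[Y≡]≈P m = weight-filter (firstAppears? k) (completes k k) (firstAppears?-completes k) (outcomes m)

  -- The probability that the first i + 1 flips are HⁱT.
  w : ℕ → Carrier
  w i = p ^ i * q

  -- Stated for every r because a head leads from r + 1 missing heads to r, whereas a tail always
  -- leads back to k. `shift` accounts for the flips spent.
  waiting-firstTail : ∀ r m →
    waiting r m ≈ p ^ r * shift r δ m + Σ (λ i → w i * shift (suc i) P m) r
  waiting-firstTail zero    zero    = solve 0 (con (+ 1) :+ con (+ 0) := con (+ 1) :* con (+ 1) :+ con (+ 0)) refl
  waiting-firstTail zero    (suc m) = begin
    waiting 0 (suc m)
      ≈⟨ weight-outcomes (completes k 0) m ⟩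
    p * weight (λ _ → false) (outcomes m) + q * weight (λ _ → false) (outcomes m)
      ≈⟨ +-cong (*-congˡ (weight-false (outcomes m))) (*-congˡ (weight-false (outcomes m))) ⟩
    p * 0# + q * 0#
      ≈⟨ solve 2 (λ p q → p :* con (+ 0) :+ q :* con (+ 0) := con (+ 1) :* con (+ 0) :+ con (+ 0)) refl p q ⟩
    1# * 0# + 0# ∎
  waiting-firstTail (suc r) zero    = +-cong (sym (zeroʳ _)) (sym (Σ-0 {λ i → w i * 0#} (suc r) (λ i → zeroʳ (w i))))
  waiting-firstTail (suc r) (suc m) = begin
    waiting (suc r) (suc m)
      ≈⟨ weight-outcomes (completes k (suc r)) m ⟩
    p * waiting r m + q * P m
      ≈⟨ +-congʳ (*-congˡ (waiting-firstTail r m)) ⟩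
    p * (p ^ r * shift r δ m + s) + q * P m
      ≈⟨ solve 6 (λ p pʳ d s q x → p :* (pʳ :* d :+ s) :+ q :* x := p :* pʳ :* d :+ (con (+ 1) :* q :* x :+ p :* s))
           refl p (p ^ r) (shift r δ m) s q (P m) ⟩
    p ^ suc r * shift r δ m + (w 0 * P m + p * s)
      ≈⟨ +-congˡ (+-congˡ (trans (*-Σ p (λ i → w i * shift (suc i) P m) r) (Σ-cong r (λ i →
           solve 4 (λ p pⁱ q x → p :* (pⁱ :* q :* x) := p :* pⁱ :* q :* x) refl p (p ^ i) q (shift (suc i) P m))))) ⟩
    p ^ suc r * shift r δ m + (w 0 * P m + Σ (λ i → w (suc i) * shift (suc i) P m) r) ∎
    where s = Σ (λ i → w i * shift (suc i) P m) r

  0≤if : ∀ b {x} → 0# ≤ x → 0# ≤ (if b then x else 0#)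
  0≤if true  0≤x = 0≤x
  0≤if false 0≤x = ≤-refl

  0≤probability : ∀ v → 0# ≤ probability v
  0≤probability []      = <⇒≤ 0<1
  0≤probability (H ∷ v) = 0≤* (<⇒≤ 0<p) (0≤probability v)
  0≤probability (T ∷ v) = 0≤* (<⇒≤ 0<q) (0≤probability v)

  0≤weight : ∀ f ws → 0# ≤ weight f ws
  0≤weight f []       = ≤-refl
  0≤weight f (v ∷ ws) = 0≤+ (0≤if (f v) (0≤probability v)) (0≤weight f ws)

  -- The events Hⁱ T with i < r and the event Hʳ exhaust all possibilities.
  w-total : ∀ r → p ^ r + Σ w r ≈ 1#
  w-total zero    = +-identityʳ 1#
  w-total (suc r) = begin
    p * p ^ r + (1# * q + Σ (w ∘ suc) r)
      ≈⟨ +-congˡ (+-congˡ (trans (Σ-cong r (λ i → *-assoc p (p ^ i) q)) (sym (*-Σ p w r)))) ⟩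
    p * p ^ r + (1# * q + p * Σ w r)
      ≈⟨ solve 3 (λ p pʳ s → p :* pʳ :+ (con (+ 1) :* (con (+ 1) :- p) :+ p :* s) := p :* (pʳ :+ s) :+ (con (+ 1) :- p)) refl p (p ^ r) (Σ w r) ⟩
    p * (p ^ r + Σ w r) + q
      ≈⟨ +-congʳ (*-congˡ (w-total r)) ⟩
    p * 1# + q
      ≈⟨ solve 1 (λ p → p :* con (+ 1) :+ (con (+ 1) :- p) := con (+ 1)) refl p ⟩
    1# ∎

  -- Truncated moments

  momentTerm : ℕ → ℕ → Carrier
  momentTerm n m = fromℕ m ^ n * P m

  S : ℕ → ℕ → Carrier
  S n = Σ (momentTerm n)

  0≤momentTerm : ∀ n m → 0# ≤ momentTerm n m
  0≤momentTerm n m = 0≤* (0≤^ n (0≤fromℕ m)) (0≤weight (completes k k) (outcomes m))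

  S-firstTail : ∀ n N → S n N ≈
    p ^ k * Σ (λ m → fromℕ (k ℕ.+ m) ^ n * δ m) (N ∸ k) +
    Σ (λ i → w i * Σ (λ m → fromℕ (suc i ℕ.+ m) ^ n * P m) (N ∸ suc i)) k
  S-firstTail n N = begin
    Σ (λ m → fromℕ m ^ n * P m) N
      ≈⟨ Σ-cong N (λ m → trans (*-congˡ (waiting-firstTail k m)) (expand m)) ⟩
    Σ (λ m → p ^ k * d m + Σ (λ i → w i * x i m) k) N
      ≈⟨ Σ-+ (λ m → p ^ k * d m) (λ m → Σ (λ i → w i * x i m) k) N ⟩
    Σ (λ m → p ^ k * d m) N + Σ (λ m → Σ (λ i → w i * x i m) k) N
      ≈⟨ +-cong (trans (sym (*-Σ (p ^ k) d N)) (*-congˡ (Σ-shift k δ (λ m → fromℕ m ^ n) N)))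
           (trans (Σ-comm (λ m i → w i * x i m) N k) (Σ-cong k (λ i →
             trans (sym (*-Σ (w i) (x i) N)) (*-congˡ (Σ-shift (suc i) P (λ m → fromℕ m ^ n) N))))) ⟩
    p ^ k * Σ (λ m → fromℕ (k ℕ.+ m) ^ n * δ m) (N ∸ k) +
      Σ (λ i → w i * Σ (λ m → fromℕ (suc i ℕ.+ m) ^ n * P m) (N ∸ suc i)) k ∎
    where
    d : ℕ → Carrier
    d m = fromℕ m ^ n * shift k δ m
    x : ℕ → ℕ → Carrier
    x i m = fromℕ m ^ n * shift (suc i) P m
    expand : ∀ m → fromℕ m ^ n * (p ^ k * shift k δ m + Σ (λ i → w i * shift (suc i) P m) k) ≈
      p ^ k * d m + Σ (λ i → w i * x i m) k
    expand m = begin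
      mⁿ * (p ^ k * shift k δ m + Σ (λ i → w i * shift (suc i) P m) k)
        ≈⟨ solve 4 (λ c pᵏ d s → c :* (pᵏ :* d :+ s) := pᵏ :* (c :* d) :+ c :* s) refl mⁿ (p ^ k) (shift k δ m) (Σ (λ i → w i * shift (suc i) P m) k) ⟩
      p ^ k * d m + mⁿ * Σ (λ i → w i * shift (suc i) P m) k
        ≈⟨ +-congˡ (trans (*-Σ mⁿ (λ i → w i * shift (suc i) P m) k) (Σ-cong k (λ i →
             solve 3 (λ c w y → c :* (w :* y) := w :* (c :* y)) refl mⁿ (w i) (shift (suc i) P m)))) ⟩
      p ^ k * d m + Σ (λ i → w i * x i m) k ∎
      where mⁿ = fromℕ m ^ n

  -- The coefficient of mʲ in (m + (i + 1))ⁿ.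
  a : ℕ → ℕ → ℕ → Carrier
  a n j i = fromℕ (n C j) * fromℕ (suc i) ^ (n ∸ j)

  shiftedMoment : ∀ n i M → Σ (λ m → fromℕ (suc i ℕ.+ m) ^ n * P m) M ≈ Σ (λ j → a n j i * S j M) (suc n)
  shiftedMoment n i M = begin
    Σ (λ m → fromℕ (suc i ℕ.+ m) ^ n * P m) M
      ≈⟨ Σ-cong M term ⟩
    Σ (λ m → Σ (λ j → a n j i * momentTerm j m) (suc n)) M
      ≈⟨ Σ-comm (λ m j → a n j i * momentTerm j m) M (suc n) ⟩
    Σ (λ j → Σ (λ m → a n j i * momentTerm j m) M) (suc n)
      ≈⟨ Σ-cong {λ j → Σ (λ m → a n j i * momentTerm j m) M} {λ j → a n j i * S j M} (suc n)
           (λ j → sym (*-Σ (a n j i) (momentTerm j) M)) ⟩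
    Σ (λ j → a n j i * S j M) (suc n) ∎
    where
    term : ∀ m → fromℕ (suc i ℕ.+ m) ^ n * P m ≈ Σ (λ j → a n j i * momentTerm j m) (suc n)
    term m = begin
      fromℕ (suc i ℕ.+ m) ^ n * P m
        ≈⟨ *-congʳ (^-congˡ n (trans (fromℕ-+ (suc i) m) (+-comm _ _))) ⟩
      (fromℕ m + fromℕ (suc i)) ^ n * P m
        ≈⟨ *-congʳ (binomialTheorem n (fromℕ m) (fromℕ (suc i))) ⟩
      Σ b (suc n) * P m
        ≈⟨ *-comm _ _ ⟩
      P m * Σ b (suc n)
        ≈⟨ *-Σ (P m) b (suc n) ⟩
      Σ (λ j → P m * b j) (suc n)
        ≈⟨ Σ-cong {λ j → P m * b j} {λ j → a n j i * momentTerm j m} (suc n) (λ j →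
             solve 4 (λ x c y z → x :* (c :* (y :* z)) := c :* z :* (y :* x)) refl
               (P m) (fromℕ (n C j)) (fromℕ m ^ j) (fromℕ (suc i) ^ (n ∸ j))) ⟩
      Σ (λ j → a n j i * momentTerm j m) (suc n) ∎
      where
      b : ℕ → Carrier
      b j = fromℕ (n C j) * (fromℕ m ^ j * fromℕ (suc i) ^ (n ∸ j))

  -- The coefficient of the j-th moment in the recurrence for the n-th one, after multiplication by
  -- pᵏ.
  b : ℕ → ℕ → Carrier
  b n j = Σ (λ i → w i * a n j i) k

  -- For j = n the binomial weights are 1, so the n-th moment recurs with the total probability of
  -- meeting a tail within k flips.
  bnn≈Σw : ∀ n → b n n ≈ Σ w k
  bnn≈Σw n = Σ-cong k λ i → begin
    w i * (fromℕ (n C n) * fromℕ (suc i) ^ (n ∸ n))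
      ≡⟨ ≡.cong₂ (λ x y → w i * (fromℕ x * fromℕ (suc i) ^ y)) (nCn≡1 n) (ℕ.n∸n≡0 n) ⟩
    w i * ((1# + 0#) * 1#)
      ≈⟨ solve 1 (λ x → x :* ((con (+ 1) :+ con (+ 0)) :* con (+ 1)) := x) refl (w i) ⟩
    w i ∎

  K^_ : ℕ → Carrier
  K^ n = fromℕ k ^ n

  -- Both summands are truncation effects: the first restores the outcome Hᵏ when N ≤ k cuts it off,
  -- the second the last i + 1 terms lost when a restart after i + 1 flips leaves only N - (i + 1)
  -- of them.
  remainder : ℕ → ℕ → Carrier
  remainder n N = p ^ k * (δ (N ∸ k) * K^ n) +
    Σ (λ i → w i * Σ (λ j → a n j i * gap (suc i) (momentTerm j) N) (suc n)) k

  S-recurrence : ∀ n N → p ^ k * S n N + remainder n N ≈ p ^ k * K^ n + Σ (λ j → b n j * S j N) n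
  S-recurrence n N = begin
    p ^ k * S n N + remainder n N
      -- Adding and subtracting `Σ w k * S n N` completes pᵏ to the total mass 1, so that `S n N`
      -- can be expanded as a whole.
      ≈⟨ solve 4 (λ pᵏ s r v → pᵏ :* s :+ r := (pᵏ :+ v) :* s :+ r :- v :* s) refl (p ^ k) (S n N) (remainder n N) (Σ w k) ⟩
    (p ^ k + Σ w k) * S n N + remainder n N - Σ w k * S n N
      ≈⟨ +-congʳ (+-congʳ (trans (*-congʳ (w-total k)) (*-identityˡ _))) ⟩
    S n N + remainder n N - Σ w k * S n N
      ≈⟨ +-congʳ full ⟩
    p ^ k * K^ n + (Σ (λ j → b n j * S j N) n + b n n * S n N) - Σ w k * S n N
      ≈⟨ +-congʳ (+-congˡ (+-congˡ (*-congʳ (bnn≈Σw n)))) ⟩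
    p ^ k * K^ n + (Σ (λ j → b n j * S j N) n + Σ w k * S n N) - Σ w k * S n N
      ≈⟨ solve 3 (λ x y z → x :+ (y :+ z) :- z := x :+ y) refl (p ^ k * K^ n) (Σ (λ j → b n j * S j N) n) (Σ w k * S n N) ⟩
    p ^ k * K^ n + Σ (λ j → b n j * S j N) n ∎
    where
    head = Σ (λ m → fromℕ (k ℕ.+ m) ^ n * δ m) (N ∸ k)

    head+δ : head + δ (N ∸ k) * K^ n ≈ K^ n
    head+δ = ≡.subst (λ l → head + δ (N ∸ k) * fromℕ l ^ n ≈ fromℕ l ^ n) (ℕ.+-identityʳ k)
      (Σ-δ (λ m → fromℕ (k ℕ.+ m) ^ n) (N ∸ k))

    inner : ∀ i → Σ (λ m → fromℕ (suc i ℕ.+ m) ^ n * P m) (N ∸ suc i) +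
      Σ (λ j → a n j i * gap (suc i) (momentTerm j) N) (suc n) ≈ Σ (λ j → a n j i * S j N) (suc n)
    inner i = begin
      Σ (λ m → fromℕ (suc i ℕ.+ m) ^ n * P m) (N ∸ suc i) + Σ g (suc n)
        ≈⟨ +-congʳ (shiftedMoment n i (N ∸ suc i)) ⟩
      Σ f (suc n) + Σ g (suc n)
        ≈⟨ Σ-+ f g (suc n) ⟨
      Σ (λ j → f j + g j) (suc n)
        ≈⟨ Σ-cong {λ j → f j + g j} {λ j → a n j i * S j N} (suc n) (λ j →
             trans (sym (distribˡ (a n j i) _ _)) (*-congˡ (sym (Σ-gap (suc i) (momentTerm j) N)))) ⟩
      Σ (λ j → a n j i * S j N) (suc n) ∎
      where
      f g : ℕ → Carrier
      f j = a n j i * S j (N ∸ suc i)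
      g j = a n j i * gap (suc i) (momentTerm j) N

    swap : Σ (λ i → w i * Σ (λ j → a n j i * S j N) (suc n)) k ≈ Σ (λ j → b n j * S j N) (suc n)
    swap = begin
      Σ (λ i → w i * Σ (λ j → a n j i * S j N) (suc n)) k
        ≈⟨ Σ-cong k (λ i → trans (*-Σ (w i) (λ j → a n j i * S j N) (suc n))
             (Σ-cong {λ j → w i * (a n j i * S j N)} {λ j → S j N * (w i * a n j i)} (suc n) (λ j →
               solve 3 (λ w a s → w :* (a :* s) := s :* (w :* a)) refl (w i) (a n j i) (S j N)))) ⟩
      Σ (λ i → Σ (λ j → S j N * (w i * a n j i)) (suc n)) k
        ≈⟨ Σ-comm (λ i j → S j N * (w i * a n j i)) k (suc n) ⟩
      Σ (λ j → Σ (λ i → S j N * (w i * a n j i)) k) (suc n)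
        ≈⟨ Σ-cong {λ j → Σ (λ i → S j N * (w i * a n j i)) k} {λ j → b n j * S j N} (suc n) (λ j →
             trans (sym (*-Σ (S j N) (λ i → w i * a n j i) k)) (*-comm _ _)) ⟩
      Σ (λ j → b n j * S j N) (suc n) ∎

    full : S n N + remainder n N ≈ p ^ k * K^ n + (Σ (λ j → b n j * S j N) n + b n n * S n N)
    full = begin
      S n N + remainder n N
        ≈⟨ +-congʳ (S-firstTail n N) ⟩
      p ^ k * head + Σ u k + (p ^ k * (δ (N ∸ k) * K^ n) + Σ v k)
        ≈⟨ solve 5 (λ pᵏ h u z v → pᵏ :* h :+ u :+ (pᵏ :* z :+ v) := pᵏ :* (h :+ z) :+ (u :+ v)) refl
             (p ^ k) head (Σ u k) (δ (N ∸ k) * K^ n) (Σ v k) ⟩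
      p ^ k * (head + δ (N ∸ k) * K^ n) + (Σ u k + Σ v k)
        ≈⟨ +-cong (*-congˡ head+δ) (trans (sym (Σ-+ u v k)) (Σ-cong k (λ i →
             trans (sym (distribˡ (w i) _ _)) (*-congˡ (inner i))))) ⟩
      p ^ k * K^ n + Σ (λ i → w i * Σ (λ j → a n j i * S j N) (suc n)) k
        ≈⟨ +-congˡ (trans swap (Σ-last (λ j → b n j * S j N) n)) ⟩
      p ^ k * K^ n + (Σ (λ j → b n j * S j N) n + b n n * S n N) ∎
      where
      u v : ℕ → Carrier
      u i = w i * Σ (λ m → fromℕ (suc i ℕ.+ m) ^ n * P m) (N ∸ suc i)
      v i = w i * Σ (λ j → a n j i * gap (suc i) (momentTerm j) N) (suc n)

  0<pᵏ : 0# < p ^ k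
  0<pᵏ = ^-pos k 0<p

  0≤w : ∀ i → 0# ≤ w i
  0≤w i = 0≤* (0≤^ i (<⇒≤ 0<p)) (<⇒≤ 0<q)

  0≤a : ∀ n j i → 0# ≤ a n j i
  0≤a n j i = 0≤* (0≤fromℕ (n C j)) (0≤^ (n ∸ j) (0≤fromℕ (suc i)))

  0≤b : ∀ n j → 0# ≤ b n j
  0≤b n j = 0≤Σ k (λ i → 0≤* (0≤w i) (0≤a n j i))

  0≤K^ : ∀ n → 0# ≤ K^ n
  0≤K^ n = 0≤^ n (0≤fromℕ k)

  0≤remainder : ∀ n N → 0# ≤ remainder n N
  0≤remainder n N = 0≤+ (0≤* (<⇒≤ 0<pᵏ) (0≤* (0≤δ (N ∸ k)) (0≤K^ n)))
    (0≤Σ k (λ i → 0≤* (0≤w i) (0≤Σ {λ j → a n j i * gap (suc i) (momentTerm j) N} (suc n) (λ j →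
      0≤* (0≤a n j i) (0≤gap (0≤momentTerm j) (suc i) N)))))

  bounded-S : ∀ n → Bounded (S n)
  bounded-S = <-rec (λ n → Bounded (S n)) λ n bounded → bounded-cancel 0<pᵏ
    (bounded-≤ (λ N → 0≤* (<⇒≤ 0<pᵏ) (0≤Σ N (0≤momentTerm n)))
      (λ N → ≤-trans (x≤x+y _ (0≤remainder n N)) (≈⇒≤ (S-recurrence n N)))
      (bounded-+ (bounded-const (0≤* (<⇒≤ 0<pᵏ) (0≤K^ n)))
        (bounded-Σ {λ j N → b n j * S j N} n (λ j j<n → bounded-* (0≤b n j) (bounded j<n)))))

  vanishing-momentTerm : ∀ n → Vanishing (momentTerm n)
  vanishing-momentTerm n = bounded-cong (λ m → *-assoc (fromℕ m) (fromℕ m ^ n) (P m))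
    (bounded-term (0≤momentTerm (suc n)) (bounded-S (suc n)))

  vanishing-remainder : ∀ n → Vanishing (remainder n)
  vanishing-remainder n = vanishing-+
    (vanishing-* (<⇒≤ 0<pᵏ) (vanishing-cong (λ N → *-comm (K^ n) (δ (N ∸ k))) (vanishing-* (0≤K^ n) (vanishing-δ k))))
    (vanishing-Σ {λ i N → w i * Σ (λ j → a n j i * gap (suc i) (momentTerm j) N) (suc n)} k (λ i _ → vanishing-* (0≤w i)
      (vanishing-Σ {λ j N → a n j i * gap (suc i) (momentTerm j) N} (suc n) (λ j _ → vanishing-* (0≤a n j i)
        (vanishing-gap (suc i) (bounded-term (0≤momentTerm j) (bounded-S j)) (vanishing-momentTerm j))))))

  -- The moments

  d : ℕ → ℕ → Carrier
  d n j = ∑[ i′ < k ] (let i = suc (toℕ i′) in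
    ((1# - p) * fromℕ i ^ (n ∸ j)) / (p ^ (k ∸ i ℕ.+ 1)) [ ^-pos (k ∸ i ℕ.+ 1) 0<p ])

  -- With i counted from 0 the denominator is p^{k-i}, so multiplication by pᵏ leaves pⁱ, the weight
  -- of i heads before the tail.
  pᵏ*d : ∀ n j → p ^ k * d n j ≈ Σ (λ i → w i * fromℕ (suc i) ^ (n ∸ j)) k
  pᵏ*d n j = begin
    p ^ k * d n j     ≡⟨ ≡.cong (p ^ k *_) (∑≡Σ term k) ⟩
    p ^ k * Σ term k  ≈⟨ *-Σ (p ^ k) term k ⟩
    Σ (λ i → p ^ k * term i) k  ≈⟨ Σ-cong-< k scaled ⟩
    Σ (λ i → w i * fromℕ (suc i) ^ (n ∸ j)) k ∎
    where
    term : ℕ → Carrier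
    term i = ((1# - p) * fromℕ (suc i) ^ (n ∸ j)) / (p ^ (k ∸ suc i ℕ.+ 1)) [ ^-pos (k ∸ suc i ℕ.+ 1) 0<p ]
    scaled : ∀ i → i ℕ.< k → p ^ k * term i ≈ w i * fromℕ (suc i) ^ (n ∸ j)
    scaled i i<k = begin
      p ^ k * term i
        ≈⟨ *-congʳ (trans (^-congʳ p k≡) (^-homo-* p i (k ∸ suc i ℕ.+ 1))) ⟩
      p ^ i * p ^ (k ∸ suc i ℕ.+ 1) * term i
        ≈⟨ *-assoc (p ^ i) (p ^ (k ∸ suc i ℕ.+ 1)) (term i) ⟩
      p ^ i * (p ^ (k ∸ suc i ℕ.+ 1) * term i)
        ≈⟨ *-congˡ (y*[x/y]≈x _ (^-pos (k ∸ suc i ℕ.+ 1) 0<p)) ⟩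
      p ^ i * (q * fromℕ (suc i) ^ (n ∸ j))
        ≈⟨ *-assoc (p ^ i) q _ ⟨
      w i * fromℕ (suc i) ^ (n ∸ j) ∎
      where
      k≡ : k ≡ i ℕ.+ (k ∸ suc i ℕ.+ 1)
      -- Because `∸` truncates, this needs i < k; hence the congruence restricted to the range of
      -- the sum.
      k≡ = ≡.trans (≡.sym (ℕ.m+[n∸m]≡n i<k)) (≡.trans (≡.sym (ℕ.+-suc i (k ∸ suc i)))
        (≡.cong (i ℕ.+_) (ℕ.+-comm 1 (k ∸ suc i))))

  b≈C*pᵏ*d : ∀ n j → b n j ≈ fromℕ (n C j) * (p ^ k * d n j)
  b≈C*pᵏ*d n j = begin
    Σ (λ i → w i * a n j i) k
      ≈⟨ Σ-cong k (λ i → solve 3 (λ w c x → w :* (c :* x) := c :* (w :* x)) refl (w i) (fromℕ (n C j)) (fromℕ (suc i) ^ (n ∸ j))) ⟩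
    Σ (λ i → fromℕ (n C j) * (w i * fromℕ (suc i) ^ (n ∸ j))) k
      ≈⟨ *-Σ (fromℕ (n C j)) (λ i → w i * fromℕ (suc i) ^ (n ∸ j)) k ⟨
    fromℕ (n C j) * Σ (λ i → w i * fromℕ (suc i) ^ (n ∸ j)) k
      ≈⟨ *-congˡ (pᵏ*d n j) ⟨
    fromℕ (n C j) * (p ^ k * d n j) ∎

  -- The value at n depends on E only below n, so a fixed point is determined by course-of-values
  -- recursion.
  next : (ℕ → Carrier) → ℕ → Carrier
  next E n = K^ n + Σ (λ j → fromℕ (n C j) * E j * d n j) n

  next-cong : ∀ {E E′} n → (∀ j → j ℕ.< n → E j ≈ E′ j) → next E n ≈ next E′ n
  next-cong n E≈E′ = +-congˡ (Σ-cong-< n (λ j j<n → *-congʳ (*-congˡ (E≈E′ j j<n))))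

  -- The iterates of next from 0 become constant at n after n + 1 steps.
  iterate : ℕ → ℕ → Carrier
  iterate zero    n = 0#
  iterate (suc l) n = next (iterate l) n

  iterate-stable : ∀ l l′ n → n ℕ.< l → n ℕ.< l′ → iterate l n ≈ iterate l′ n
  iterate-stable (suc l) (suc l′) n (s≤s n≤l) (s≤s n≤l′) = next-cong {iterate l} {iterate l′} n
    (λ j j<n → iterate-stable l l′ j (ℕ.<-≤-trans j<n n≤l) (ℕ.<-≤-trans j<n n≤l′))

  moment : ℕ → Carrier
  moment n = iterate (suc n) n

  moment-recurrence : ∀ n → moment n ≈ next moment n
  moment-recurrence n = next-cong {iterate n} {moment} n (λ j j<n → iterate-stable n (suc j) j j<n (ℕ.n<1+n j))

  pᵏ*moment : ∀ n → p ^ k * moment n ≈ p ^ k * K^ n + Σ (λ j → b n j * moment j) n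
  pᵏ*moment n = begin
    p ^ k * moment n
      ≈⟨ *-congˡ (moment-recurrence n) ⟩
    p ^ k * (K^ n + Σ (λ j → fromℕ (n C j) * moment j * d n j) n)
      ≈⟨ distribˡ _ _ _ ⟩
    p ^ k * K^ n + p ^ k * Σ (λ j → fromℕ (n C j) * moment j * d n j) n
      ≈⟨ +-congˡ (trans (*-Σ (p ^ k) (λ j → fromℕ (n C j) * moment j * d n j) n) (Σ-cong n (λ j → trans
           (solve 4 (λ pᵏ c e d → pᵏ :* (c :* e :* d) := c :* (pᵏ :* d) :* e) refl (p ^ k) (fromℕ (n C j)) (moment j) (d n j))
           (*-congʳ (sym (b≈C*pᵏ*d n j)))))) ⟩
    p ^ k * K^ n + Σ (λ j → b n j * moment j) n ∎

  -- The difference of the exact and the truncated recurrence. All coefficients on the left are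
  -- nonnegative, so the error inherits its sign and its decay from the remainder and the lower
  -- errors.
  moment-error : ∀ n N → remainder n N + Σ (λ j → b n j * (moment j - S j N)) n ≈ p ^ k * (moment n - S n N)
  moment-error n N = begin
    r + u
      ≈⟨ solve 4 (λ r u s x → r :+ u := x :+ (u :+ s) :- (x :+ s) :+ r) refl r u s (p ^ k * K^ n) ⟩
    p ^ k * K^ n + (u + s) - (p ^ k * K^ n + s) + r
      ≈⟨ +-congʳ (+-cong (+-congˡ u+s) (-‿cong (sym (S-recurrence n N)))) ⟩
    p ^ k * K^ n + Σ (λ j → b n j * moment j) n - (p ^ k * S n N + r) + r
      ≈⟨ +-congʳ (+-congʳ (sym (pᵏ*moment n))) ⟩
    p ^ k * moment n - (p ^ k * S n N + r) + r
      ≈⟨ solve 4 (λ pᵏ e s r → pᵏ :* e :- (pᵏ :* s :+ r) :+ r := pᵏ :* (e :- s)) refl (p ^ k) (moment n) (S n N) r ⟩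
    p ^ k * (moment n - S n N) ∎
    where
    r = remainder n N
    u = Σ (λ j → b n j * (moment j - S j N)) n
    s = Σ (λ j → b n j * S j N) n
    u+s : u + s ≈ Σ (λ j → b n j * moment j) n
    u+s = trans (sym (Σ-+ (λ j → b n j * (moment j - S j N)) (λ j → b n j * S j N) n)) (Σ-cong n (λ j →
      solve 3 (λ b e s → b :* (e :- s) :+ b :* s := b :* e) refl (b n j) (moment j) (S j N)))

  vanishing-error : ∀ n → Vanishing (λ N → moment n - S n N)
  vanishing-error = <-rec (λ n → Vanishing (λ N → moment n - S n N)) λ n vanishing → vanishing-cancel 0<pᵏ
    (vanishing-cong (moment-error n) (vanishing-+ (vanishing-remainder n)
      (vanishing-Σ {λ j N → b n j * (moment j - S j N)} n (λ j j<n → vanishing-* (0≤b n j) (vanishing j<n)))))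

  E[Y^n]≈moment : ∀ n → E[Y^ n ]≈ moment n
  E[Y^n]≈moment n = bounded⇒⟶ (vanishing-cong (λ N → +-congˡ (-‿cong (truncated N))) (vanishing-error n))
    where
    truncated : ∀ N → S n N ≈ ∑[ m < N ] (fromℕ (toℕ m) ^ n * P[Y≡ toℕ m ])
    truncated N = trans (Σ-cong N (λ m → *-congˡ (sym (P[Y≡]≈P m))))
      (reflexive (≡.sym (∑≡Σ (λ m → fromℕ m ^ n * P[Y≡ m ]) N)))

  -- Uniqueness of limits identifies any given moments with the constructed ones, for which the
  -- recurrence is already known.
  moments-recurrence : ∀ (E : ℕ → Carrier) → (∀ n → E[Y^ n ]≈ E n) → ∀ n → E n ≈ next E n
  moments-recurrence E isE n = trans (E≈moment n) (trans (moment-recurrence n)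
    (next-cong {moment} {E} n (λ j _ → sym (E≈moment j))))
    where
    E≈moment : ∀ n → E n ≈ moment n
    E≈moment n = ⟶-unique (isE n) (E[Y^n]≈moment n)

  eulerianForm : ℕ → ℕ → Carrier
  eulerianForm n j = ∑[ i < suc n ] (
    (fromℤ (eulerian (n ∸ j) (+ toℕ i)) * p ^ toℕ i
      - fromℤ (eulerianᵏ (+ k) (n ∸ j) (+ toℕ i)) * p ^ (k ℕ.+ toℕ i ℕ.+ 1))
      / ((1# - p) ^ (n ∸ j) * p ^ (k ℕ.+ 1))
        [ *-pos (^-pos (n ∸ j) 0<q) (^-pos (k ℕ.+ 1) 0<p) ])

  -- Compared after multiplication by the common denominator. j < n gives the exponent n - j ≥ 1
  -- that `eulerian-sum` requires, and n + 1 terms cover all coefficients because n - j ≤ n.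
  d≈eulerianForm : ∀ {n j} → j ℕ.< n → d n j ≈ eulerianForm n j
  d≈eulerianForm {n} {j} j<n = *-cancelˡ-≈ 0<D (begin
    D * d n j
      ≈⟨ *-congʳ (*-congˡ (^-congʳ p (ℕ.+-comm k 1))) ⟩
    q ^ m * (p * p ^ k) * d n j
      ≈⟨ solve 4 (λ qᵐ p pᵏ d → qᵐ :* (p :* pᵏ) :* d := qᵐ :* p :* (pᵏ :* d)) refl (q ^ m) p (p ^ k) (d n j) ⟩
    q ^ m * p * (p ^ k * d n j)
      ≈⟨ *-congˡ (pᵏ*d n j) ⟩
    q ^ m * p * Σ (λ i → w i * fromℕ (suc i) ^ m) k
      ≈⟨ *-Σ (q ^ m * p) (λ i → w i * fromℕ (suc i) ^ m) k ⟩
    Σ (λ i → q ^ m * p * (w i * fromℕ (suc i) ^ m)) k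
      ≈⟨ Σ-cong k (λ i → solve 5 (λ qᵐ p pⁱ q x → qᵐ :* p :* (pⁱ :* q :* x) := q :* qᵐ :* (x :* (p :* pⁱ))) refl
           (q ^ m) p (p ^ i) q (fromℕ (suc i) ^ m)) ⟩
    Σ (λ i → q ^ suc m * (fromℕ (suc i) ^ m * p ^ suc i)) k
      ≈⟨ *-Σ (q ^ suc m) (λ i → fromℕ (suc i) ^ m * p ^ suc i) k ⟨
    q ^ suc m * Σ (λ i → fromℕ (suc i) ^ m * p ^ suc i) k
      ≈⟨ eulerian-sum p k (ℕ.m<n⇒0<n∸m j<n) (s≤s (ℕ.m∸n≤m n j)) ⟨
    Σ numerator (suc n)
      ≈⟨ Σ-cong {numerator} {λ i → D * (numerator i / D [ 0<D ])} (suc n) (λ i → sym (y*[x/y]≈x (numerator i) 0<D)) ⟩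
    Σ (λ i → D * (numerator i / D [ 0<D ])) (suc n)
      ≈⟨ *-Σ D (λ i → numerator i / D [ 0<D ]) (suc n) ⟨
    D * Σ (λ i → numerator i / D [ 0<D ]) (suc n)
      ≡⟨ ≡.cong (D *_) (∑≡Σ (λ i → numerator i / D [ 0<D ]) (suc n)) ⟨
    D * eulerianForm n j ∎)
    where
    m = n ∸ j
    D = (1# - p) ^ m * p ^ (k ℕ.+ 1)
    0<D : 0# < D
    0<D = *-pos (^-pos m 0<q) (^-pos (k ℕ.+ 1) 0<p)
    numerator : ℕ → Carrier
    numerator i = fromℤ (eulerian m (+ i)) * p ^ i - fromℤ (eulerianᵏ (+ k) m (+ i)) * p ^ (k ℕ.+ i ℕ.+ 1)

theorem3p1 :
    ∀ {c ℓ₁ ℓ₂ ℓ₃} (F : ArchimedeanOrderedField c ℓ₁ ℓ₂ ℓ₃) →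
    let open ArchimedeanOrderedField F in
    (p : Carrier) (0<p : 0# < p) (p<1 : p < 1#) (k : ℕ) → 1 ℕ.≤ k →
    let open CoinFlips F p k
        0<1-p = x<y⇒0<y-x p<1
    in
    (∀ n → ∃ λ e → E[Y^ n ]≈ e) ×
    (∀ (E : ℕ → Carrier) → (∀ n → E[Y^ n ]≈ E n) →
      (E 0 ≈ 1#) ×
      (∀ n → 1 ℕ.≤ n →
        let
          first =
            fromℕ k ^ n +
            ∑[ j < n ] (fromℕ (n C toℕ j) * E (toℕ j) *
              ∑[ i′ < k ] (let i = suc (toℕ i′) in
                ((1# - p) * fromℕ i ^ (n ∸ toℕ j))
                  / (p ^ (k ∸ i ℕ.+ 1)) [ ^-pos (k ∸ i ℕ.+ 1) 0<p ]))
          second =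
            fromℕ k ^ n +
            ∑[ j < n ] (fromℕ (n C toℕ j) * E (toℕ j) *
              ∑[ i < suc n ] (
                (fromℤ (eulerian (n ∸ toℕ j) (+ toℕ i)) * p ^ toℕ i
                  - fromℤ (eulerianᵏ (+ k) (n ∸ toℕ j) (+ toℕ i)) * p ^ (k ℕ.+ toℕ i ℕ.+ 1))
                  / ((1# - p) ^ (n ∸ toℕ j) * p ^ (k ℕ.+ 1))
                    [ *-pos (^-pos (n ∸ toℕ j) 0<1-p) (^-pos (k ℕ.+ 1) 0<p) ]))
        in (E n ≈ first) × (first ≈ second)))
theorem3p1 F p 0<p p<1 k _ =
  (λ n → moment n , E[Y^n]≈moment n) ,
  λ E isE →
    -- At n = 0 the sum is empty and the recurrence reads 1 + 0.
    trans (moments-recurrence E isE 0) (+-identityʳ 1#) ,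
    λ n _ →
      let first≡next = ≡.cong (λ s → fromℕ k ^ n + s) (∑≡Σ (λ j → fromℕ (n C j) * E j * d n j) n)
      in
      trans (moments-recurrence E isE n) (reflexive (≡.sym first≡next)) ,
      trans (reflexive first≡next) (+-congˡ (trans
        (Σ-cong-< n (λ j j<n → *-congˡ (d≈eulerianForm j<n)))
        (reflexive (≡.sym (∑≡Σ (λ j → fromℕ (n C j) * E j * eulerianForm n j) n)))))
  where
  open OrderedField F
  open RunMoments F p 0<p p<1 k
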